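{- Let $k$ be a positive integer and let $G$ be a finite simple graph satisfying the NC property which is the union of $k$ pairwise edge-disjoint copies of $K_k$ (i.e., $V(G)$ and $E(G)$ are the unions of the vertex sets and edge sets of $k$ cliques $L_1,\ldots,L_k$ of size $k$, no two sharing an edge). Then $\chi_{DP}(G)=k$.
   Context: A hole of a graph is an induced cycle of length at least $4$. A nonempty set $X\subseteq V(G)$ is a hole cover of $G$ if every hole of $G$ contains at least one vertex of $X$ (if $G$ has no hole, every nonempty vertex set is a hole cover). A vertex $u$ satisfies the NC property in $G$ if no hole of $G$ containing $u$ and hole of $G$ not containing $u$ share two consecutive edges. A set $\mathcal{C}$ satisfies the NC property in $G$ if each vertex of $\mathcal{C}$ satisfies the NC property in $G$ and every hole of $G$ contains at most one vertex of $\mathcal{C}$. $G$ satisfies the NC property if it has a hole cover satisfying the NC property in $G$. $\chi_{DP}$ denotes the DP-chromatic (correspondence chromatic) number. -}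

module Defs where

open import Data.Nat using (ℕ; zero; suc; _≤_; _<_)
open import Data.Fin using (Fin; toℕ)
open import Data.Bool using (Bool; true; false)
open import Data.Product using (Σ; ∃; ∃-syntax; _×_; _,_)
open import Data.Sum using (_⊎_)
open import Data.Empty using (⊥)
open import Relation.Nullary using (¬_)
open import Relation.Binary using (Decidable)
open import Relation.Binary.PropositionalEquality using (_≡_; _≢_)

record Graph : Set₁ where
  field
    n      : ℕ
    Adj    : Fin n → Fin n → Set
    adj?   : Decidable Adj
    sym    : ∀ {u v} → Adj u v → Adj v u
    irrefl : ∀ {u} → ¬ Adj u u

module _ (G : Graph) where
  open Graph G

  V : Set
  V = Fin n

  CycAdj : (m : ℕ) → Fin m → Fin m → Set
  CycAdj m i j =
      suc (toℕ i) ≡ toℕ j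
    ⊎ suc (toℕ j) ≡ toℕ i
    ⊎ (toℕ i ≡ 0 × suc (toℕ j) ≡ m)
    ⊎ (toℕ j ≡ 0 × suc (toℕ i) ≡ m)

  record Hole : Set where
    field
      len     : ℕ
      len≥4   : 4 ≤ len
      vtx     : Fin len → V
      inj     : ∀ i j → vtx i ≡ vtx j → i ≡ j
      induced : ∀ i j → (Adj (vtx i) (vtx j) → CycAdj len i j)
                      × (CycAdj len i j → Adj (vtx i) (vtx j))

  open Hole

  _∈H_ : V → Hole → Set
  u ∈H H = ∃[ i ] vtx H i ≡ u

  HoleEdge : Hole → V → V → Set
  HoleEdge H a b = ∃[ i ] ∃[ j ] (CycAdj (len H) i j × vtx H i ≡ a × vtx H j ≡ b)

  ShareTwoConsecutiveEdges : Hole → Hole → Set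
  ShareTwoConsecutiveEdges H H' =
    ∃[ a ] ∃[ b ] ∃[ c ] (a ≢ c × HoleEdge H a b × HoleEdge H b c
                                × HoleEdge H' a b × HoleEdge H' b c)

  VSet : Set₁
  VSet = V → Set

  HoleCover : VSet → Set
  HoleCover X = (∃[ u ] X u) × (∀ (H : Hole) → ∃[ i ] X (vtx H i))

  VertexNC : V → Set
  VertexNC u = ∀ (H H' : Hole) → u ∈H H → ¬ (u ∈H H') → ¬ ShareTwoConsecutiveEdges H H'

  SetNC : VSet → Set
  SetNC C = (∀ u → C u → VertexNC u)
          × (∀ (H : Hole) i j → C (vtx H i) → C (vtx H j) → i ≡ j)

  NCProperty : Set₁
  NCProperty = Σ VSet λ X → HoleCover X × SetNC X

  -- A t-fold cover: vertex u gets the colour list {u} × Fin t; for each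
  -- edge uv a matching between the lists of u and v.  M u v a b = true
  -- means (u,a) and (v,b) are joined in the cover graph.
  record Cover (t : ℕ) : Set where
    field
      M         : V → V → Fin t → Fin t → Bool
      onEdges   : ∀ u v a b → M u v a b ≡ true → Adj u v
      symM      : ∀ u v a b → M u v a b ≡ M v u b a
      matchingˡ : ∀ u v a b b' → M u v a b ≡ true → M u v a b' ≡ true → b ≡ b'
      matchingʳ : ∀ u v a a' b → M u v a b ≡ true → M u v a' b ≡ true → a ≡ a'

  DPColouring : ∀ {t} → Cover t → Set
  DPColouring {t} 𝓗 = Σ (V → Fin t) λ f → ∀ u v → ¬ (Cover.M 𝓗 u v (f u) (f v) ≡ true)

  DPColourable : ℕ → Set
  DPColourable t = ∀ (𝓗 : Cover t) → DPColouring 𝓗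

  DPChromaticNumberIs : ℕ → Set
  DPChromaticNumberIs k = DPColourable k × (∀ t → t < k → ¬ DPColourable t)

  InClique : ∀ {k} → (Fin k → Fin k → V) → Fin k → V → Set
  InClique L i u = ∃[ a ] L i a ≡ u

  UnionOfEdgeDisjointCliques : (k : ℕ) → (Fin k → Fin k → V) → Set
  UnionOfEdgeDisjointCliques k L =
      (∀ i a b → L i a ≡ L i b → a ≡ b)
    × (∀ i a b → a ≢ b → Adj (L i a) (L i b))
    × (∀ u → ∃[ i ] InClique L i u)
    × (∀ u v → Adj u v → ∃[ i ] (InClique L i u × InClique L i v))
    × (∀ i j → i ≢ j → ∀ u v → u ≢ v →
         InClique L i u → InClique L i v → InClique L j u → InClique L j v → ⊥)

{-# OPTIONS --safe #-}

-- Colours are chosen greedily: every nonempty vertex set A contains a vertex with fewer than k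
-- neighbours in A.
--
-- Such a vertex comes from a near-simplicial one, whose neighbourhood in A is a clique up to one vertex.
-- For x in the hole cover let U be the union of the holes in A through x. A component of A − N[x] − U
-- is attached to a clique, because otherwise two holes would share consecutive edges while only one of
-- them contains x. So either a clique separates A, and one recurses as in Dirac's theorem, or the cover
-- vertices on holes are pairwise adjacent, no vertex misses two of them, and a simplicial vertex of the
-- chordal rest is near-simplicial in A.
--
-- If all degrees in A were at least k, the near-simplicial vertex would yield a clique Q on k vertices.
-- Its points and the k given lines form a linear space, and the de Bruijn–Erdős inequality is tight for
-- it, so any two lines meet in Q unless Q is a line; but a vertex of A outside Q lies on two lines.
module Submission where

open import Defs
open import Data.Nat using (ℕ; zero; suc; _+_; _*_; _∸_; _!; _≤_; _<_; z≤n; s≤s; NonZero; >-nonZero)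
open import Data.Nat.Divisibility using (divides; ∣-trans; m∣m*n; m≤n⇒m!∣n!)
import Data.Nat.Properties as ℕ
open import Algebra.Properties.CommutativeMonoid.Sum ℕ.+-0-commutativeMonoid using (sum; ∑-comm; sum-cong-≗)
open import Algebra.Properties.Semiring.Sum ℕ.+-*-semiring using (*-distribʳ-sum)
open import Data.Nat.Properties
  using (≤-refl; ≤-trans; ≤-reflexive; <-irrefl; n<1+n; <⇒≤; <-≤-trans; ≤-<-trans; ≤∧≢⇒<; <⇒≢; m≤n⇒m<n∨m≡n; n≮n; m≤m+n;
         suc-injective; +-suc; m+[n∸m]≡n; +-identityʳ; ≤-pred; <-trans)
open import Data.Fin using (Fin; zero; suc; toℕ; fromℕ<; lower₁; inject₁)
open import Data.Fin.Properties
  using (toℕ-injective; toℕ<n; toℕ-lower₁; toℕ-fromℕ<; toℕ-inject₁; any?; pigeonhole)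
  renaming (_≟_ to _≟F_)
import Data.Fin as F using (_<_)
import Data.Fin.Properties as F using (suc-injective)
open import Data.Fin.Subset using (Subset; _∈_; _⊆_; ∣_∣)
open import Data.Fin.Subset.Properties using (_∈?_; p⊂q⇒∣p∣<∣q∣)
open import Data.Vec using (tabulate)
open import Data.Vec.Properties using (lookup⇒[]=; []=⇒lookup; lookup∘tabulate)
open import Data.Unit using (⊤; tt)
open import Data.Bool using (true)
import Data.Bool.Properties as Bool
open import Data.List using (List; []; _∷_; length; lookup)
open import Data.List.Relation.Unary.All using (All; []; _∷_)
import Data.List.Relation.Unary.All as All
open import Data.List.Relation.Unary.All.Properties using (¬Any⇒All¬)
open import Data.List.Relation.Unary.Any using (Any; here; there)
import Data.List.Relation.Unary.Any as Any
open import Data.List.Relation.Unary.Any.Properties using (lookup-index)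
open import Data.List.Membership.Propositional.Properties using (∈-lookup)
open import Data.Product using (Σ; ∃; ∃₂; ∃-syntax; _×_; _,_; proj₁; proj₂)
open import Data.Sum using (_⊎_; inj₁; inj₂; [_,_]′)
open import Data.Empty using (⊥; ⊥-elim)
open import Function using (_∘_; id; case_of_; mk⇔)
open import Relation.Nullary using (¬_; Dec; yes; no; contradiction)
open import Relation.Nullary.Decidable
  using (does; dec-true; does-⇔; toSum; _⊎-dec_; _×-dec_; ¬¬-excluded-middle; ¬?; decidable-stable)
open import Relation.Binary.PropositionalEquality
  using (_≡_; _≢_; refl; sym; trans; cong; cong₂; subst)

-- Holes, walks and arcs

module Holes (G : Graph) where
  open Graph G public renaming (sym to adj-sym)
  open Hole public

  Vert : Set
  Vert = V G

  infixr 5 _◅_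
  data Walk (P : Vert → Set) : Vert → Vert → Set where
    end : ∀ {a} → P a → Walk P a a
    _◅_ : ∀ {a b c} → P a × Adj a b → Walk P b c → Walk P a c

  module _ {P : Vert → Set} where
    source : ∀ {a b} → Walk P a b → P a
    source (end p)       = p
    source ((p , _) ◅ _) = p

    target : ∀ {a b} → Walk P a b → P b
    target (end p) = p
    target (_ ◅ w) = target w

    _++[_]_ : ∀ {a b c d} → Walk P a b → Adj b c → Walk P c d → Walk P a d
    end p   ++[ e ] w′ = (p , e) ◅ w′
    (s ◅ w) ++[ e ] w′ = s ◅ (w ++[ e ] w′)

    _▻_ : ∀ {a b c} → Walk P a b → Adj b c × P c → Walk P a c
    w ▻ (e , p) = w ++[ e ] end p

    reverse : ∀ {a b} → Walk P a b → Walk P b a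
    reverse (end p)       = end p
    reverse ((p , e) ◅ w) = reverse w ▻ (adj-sym e , p)

    _++_ : ∀ {a b c} → Walk P a b → Walk P b c → Walk P a c
    end _   ++ w′ = w′
    (s ◅ w) ++ w′ = s ◅ (w ++ w′)

  mapW : ∀ {P Q : Vert → Set} → (∀ {v} → P v → Q v) → ∀ {a b} → Walk P a b → Walk Q a b
  mapW f (end p)       = end (f p)
  mapW f ((p , e) ◅ w) = (f p , e) ◅ mapW f w

  walk-invariant : ∀ {P Q : Vert → Set} → (∀ {u v} → Q u → P u → P v → Adj u v → Q v) →
                   ∀ {a b} → Q a → Walk P a b → Q b
  walk-invariant f q (end p)       = q
  walk-invariant f q ((p , e) ◅ w) = walk-invariant f (f q p (source w) e) w

  -- Induced paths

  Near : Vert → Vert → Set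
  Near u v = u ≡ v ⊎ Adj u v

  near? : ∀ u v → Dec (Near u v)
  near? u v = (u ≟F v) ⊎-dec adj? u v

  -- An induced path, listed without its first vertex: a repeated vertex or a chord would make some
  -- vertex `Near` one that comes at least two steps later.
  data Path : Vert → List Vert → Vert → Set where
    stop : ∀ {a} → Path a [] a
    step : ∀ {a c zs b} → Adj a c → All (¬_ ∘ Near a) zs → Path c zs b → Path a (c ∷ zs) b

  -- The path is cut at its last vertex near u; nothing after that vertex is near u, so putting u in
  -- front keeps the path induced.
  extend : ∀ {R : Vert → Set} u {c zs b} → R u → Path c zs b → Any (Near u) (c ∷ zs) → All R (c ∷ zs) →
           ∃ λ ws → Path u ws b × All R (u ∷ ws)
  extend u {c} {zs} ru π near rs with Any.any? (near? u) zs
  extend u ru (step _ _ π) near (_ ∷ rs) | yes near′ = extend u ru π near′ rs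
  extend u ru π (there near) rs | no ¬near = contradiction near ¬near
  extend u ru π (here (inj₁ refl)) rs | no ¬near = _ , π , rs
  extend u ru π (here (inj₂ e)) rs | no ¬near = _ , step e (¬Any⇒All¬ _ ¬near) π , ru ∷ rs

  walk⇒path : ∀ {R : Vert → Set} {a b} → Walk R a b → ∃ λ zs → Path a zs b × All R (a ∷ zs)
  walk⇒path (end r) = [] , stop , r ∷ []
  walk⇒path ((r , e) ◅ w) with walk⇒path w
  ... | zs , π , rs = extend _ r π (here (inj₂ e)) rs

  path⇒walk : ∀ {R : Vert → Set} {a zs b} → Path a zs b → All R (a ∷ zs) → Walk R a b
  path⇒walk stop         (r ∷ []) = end r
  path⇒walk (step e _ π) (r ∷ rs) = (r , e) ◅ path⇒walk π rs

  all-lookup : ∀ {P : Vert → Set} {xs} → All P xs → ∀ i → P (lookup xs i)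
  all-lookup ps i = All.lookup ps (∈-lookup i)

  Consecutive : ∀ {m} → Fin m → Fin m → Set
  Consecutive i j = suc (toℕ i) ≡ toℕ j ⊎ suc (toℕ j) ≡ toℕ i

  path-injective : ∀ {a zs b} → Path a zs b → ∀ i j → lookup (a ∷ zs) i ≡ lookup (a ∷ zs) j → i ≡ j
  path-injective π zero zero eq = refl
  path-injective (step e ns π) zero (suc zero) refl = contradiction e irrefl
  path-injective (step e ns π) zero (suc (suc j)) eq = contradiction (inj₁ eq) (all-lookup ns j)
  path-injective (step e ns π) (suc zero) zero refl = contradiction e irrefl
  path-injective (step e ns π) (suc (suc i)) zero eq = contradiction (inj₁ (sym eq)) (all-lookup ns i)
  path-injective (step e ns π) (suc i) (suc j) eq = cong suc (path-injective π i j eq)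

  path-adj⇒ : ∀ {a zs b} → Path a zs b → ∀ i j → Adj (lookup (a ∷ zs) i) (lookup (a ∷ zs) j) → Consecutive i j
  path-adj⇒ π zero zero e = contradiction e irrefl
  path-adj⇒ (step _ _ _) zero (suc zero) e = inj₁ refl
  path-adj⇒ (step _ ns π) zero (suc (suc j)) e = contradiction (inj₂ e) (all-lookup ns j)
  path-adj⇒ (step _ _ _) (suc zero) zero e = inj₂ refl
  path-adj⇒ (step _ ns π) (suc (suc i)) zero e = contradiction (inj₂ (adj-sym e)) (all-lookup ns i)
  path-adj⇒ (step _ _ π) (suc i) (suc j) e with path-adj⇒ π i j e
  ... | inj₁ p = inj₁ (cong suc p)
  ... | inj₂ p = inj₂ (cong suc p)

  path-step : ∀ {a zs b} → Path a zs b → ∀ i j → suc (toℕ i) ≡ toℕ j → Adj (lookup (a ∷ zs) i) (lookup (a ∷ zs) j)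
  path-step (step e _ _) zero (suc zero) refl = e
  path-step (step _ _ π) (suc i) (suc j) eq = path-step π i j (suc-injective eq)

  path-last : ∀ {a zs b} → Path a zs b → Σ (Fin (length (a ∷ zs))) λ i → toℕ i ≡ length zs × lookup (a ∷ zs) i ≡ b
  path-last stop = zero , refl , refl
  path-last (step _ _ π) with path-last π
  ... | i , eq , l = suc i , cong suc eq , l

  _∈ₕ_ : Vert → Hole G → Set
  _∈ₕ_ = _∈H_ G

  _∈ₕ?_ : ∀ v H → Dec (v ∈ₕ H)
  v ∈ₕ? H = any? λ i → vtx H i ≟F v

  hole-edge : ∀ H {a b} → a ∈ₕ H → b ∈ₕ H → Adj a b → HoleEdge G H a b
  hole-edge H (i , refl) (j , refl) e = i , j , proj₁ (induced H i j) e , refl , refl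

  -- Holes closed at an apex

  record HoleThrough (R : Vert → Set) (v a b : Vert) : Set where
    field
      hole   : Hole G
      apex∈  : v ∈ₕ hole
      left∈  : a ∈ₕ hole
      right∈ : b ∈ₕ hole
      within : ∀ {w} → w ∈ₕ hole → w ≡ v ⊎ R w
      rim    : Walk (λ w → R w × w ∈ₕ hole) a b

  module _ {R : Vert → Set} {v a b : Vert} (va : Adj v a) (vb : Adj v b) (a≢b : a ≢ b) (ab : ¬ Adj a b)
           (R-avoids : ∀ {w} → R w → w ≢ v × (Adj v w → w ≡ a ⊎ w ≡ b)) where

    private
      module Close {zs : List Vert} (π : Path a zs b) (rs : All R (a ∷ zs)) where
        f : Fin (suc (suc (length zs))) → Vert
        f = lookup (v ∷ a ∷ zs)

        4≤ : ∀ {zs} → Path a zs b → 4 ≤ suc (suc (length zs))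
        4≤ stop = contradiction refl a≢b
        4≤ (step e _ stop) = contradiction e ab
        4≤ (step _ _ (step _ _ _)) = s≤s (s≤s (s≤s (s≤s z≤n)))

        f-inj : ∀ i j → f i ≡ f j → i ≡ j
        f-inj zero zero eq = refl
        f-inj zero (suc j) eq = contradiction (sym eq) (proj₁ (R-avoids (all-lookup rs j)))
        f-inj (suc i) zero eq = contradiction eq (proj₁ (R-avoids (all-lookup rs i)))
        f-inj (suc i) (suc j) eq = cong suc (path-injective π i j eq)

        apex⇒ : ∀ j → Adj v (lookup (a ∷ zs) j) → CycAdj G (suc (suc (length zs))) zero (suc j)
        apex⇒ j e with proj₂ (R-avoids (all-lookup rs j)) e | path-last π
        ... | inj₁ p | _ = inj₁ (cong (suc ∘ toℕ) (path-injective π zero j (sym p)))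
        ... | inj₂ p | i , q , r = inj₂ (inj₂ (inj₁ (refl ,
              cong (2 +_) (trans (cong toℕ (path-injective π j i (trans p (sym r)))) q))))

        apex⇐ : ∀ j → CycAdj G (suc (suc (length zs))) zero (suc j) → Adj v (lookup (a ∷ zs) j)
        apex⇐ zero (inj₁ p) = va
        apex⇐ j (inj₂ (inj₂ (inj₁ (_ , p)))) with path-last π
        ... | i , q , r = subst (Adj v) (sym (trans (cong (lookup (a ∷ zs)) j≡i) r)) vb
          where
          j≡i : j ≡ i
          j≡i = toℕ-injective (trans (suc-injective (suc-injective p)) (sym q))

        flip : ∀ {m} {i j : Fin m} → CycAdj G m i j → CycAdj G m j i
        flip (inj₁ p) = inj₂ (inj₁ p)
        flip (inj₂ (inj₁ p)) = inj₁ p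
        flip (inj₂ (inj₂ (inj₁ p))) = inj₂ (inj₂ (inj₂ p))
        flip (inj₂ (inj₂ (inj₂ p))) = inj₂ (inj₂ (inj₁ p))

        f⇒ : ∀ i j → Adj (f i) (f j) → CycAdj G _ i j
        f⇒ zero zero e = contradiction e irrefl
        f⇒ zero (suc j) e = apex⇒ j e
        f⇒ (suc i) zero e = flip {i = zero} (apex⇒ i (adj-sym e))
        f⇒ (suc i) (suc j) e with path-adj⇒ π i j e
        ... | inj₁ p = inj₁ (cong suc p)
        ... | inj₂ p = inj₂ (inj₁ (cong suc p))

        f⇐ : ∀ i j → CycAdj G _ i j → Adj (f i) (f j)
        f⇐ zero zero (inj₂ (inj₂ (inj₁ (_ , ()))))
        f⇐ zero zero (inj₂ (inj₂ (inj₂ (_ , ()))))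
        f⇐ zero (suc j) c = apex⇐ j c
        f⇐ (suc i) zero c = adj-sym (apex⇐ i (flip {i = suc i} c))
        f⇐ (suc i) (suc j) (inj₁ p) = path-step π i j (suc-injective p)
        f⇐ (suc i) (suc j) (inj₂ (inj₁ p)) = adj-sym (path-step π j i (suc-injective p))
        f⇐ (suc i) (suc j) (inj₂ (inj₂ (inj₁ (() , _))))
        f⇐ (suc i) (suc j) (inj₂ (inj₂ (inj₂ (() , _))))

        H : Hole G
        H = record { len = _ ; len≥4 = 4≤ π ; vtx = f ; inj = f-inj ; induced = λ i j → f⇒ i j , f⇐ i j }

        H-within : ∀ {w} → w ∈ₕ H → w ≡ v ⊎ R w
        H-within (zero , refl) = inj₁ refl
        H-within (suc i , refl) = inj₂ (all-lookup rs i)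

        on-path : All (λ w → R w × w ∈ₕ H) (a ∷ zs)
        on-path = All.zip (rs , All.tabulate λ z∈ → suc (Any.index z∈) , sym (lookup-index z∈))

    -- The walk shortens to an induced path inside R. The apex v sees only its two ends, which are
    -- distinct and non-adjacent, so closing the path at v creates no chord and no triangle.
    hole-through : Walk R a b → HoleThrough R v a b
    hole-through w with walk⇒path w
    ... | zs , π , rs = record
      { hole = H ; apex∈ = zero , refl ; left∈ = suc zero , refl
      ; right∈ = let i , _ , r = path-last π in suc i , r
      ; within = H-within ; rim = path⇒walk π on-path }
      where open Close π rs

  -- Cyclic order and the arcs of a hole

  next : ∀ {m} → Fin (suc m) → Fin (suc m)
  next {m} i with m ℕ.≟ toℕ i
  ... | yes _  = zero
  ... | no m≢i = suc (lower₁ i m≢i)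

  next-step : ∀ {m} (i : Fin (suc m)) → m ≢ toℕ i → toℕ (next i) ≡ suc (toℕ i)
  next-step {m} i m≢i with m ℕ.≟ toℕ i
  ... | yes m≡i = contradiction m≡i m≢i
  ... | no m≢i′ = cong suc (toℕ-lower₁ i m≢i′)

  next-wrap : ∀ {m} (i : Fin (suc m)) → m ≡ toℕ i → next i ≡ zero
  next-wrap {m} i m≡i with m ℕ.≟ toℕ i
  ... | yes _  = refl
  ... | no m≢i = contradiction m≡i m≢i

  next-injective : ∀ {m} (i j : Fin (suc m)) → next i ≡ next j → i ≡ j
  next-injective {m} i j eq with m ℕ.≟ toℕ i | m ℕ.≟ toℕ j
  ... | yes p | yes q = toℕ-injective (trans (sym p) q)
  ... | no p  | no q  = toℕ-injective (suc-injective
        (trans (sym (cong suc (toℕ-lower₁ i p))) (trans (cong toℕ eq) (cong suc (toℕ-lower₁ j q)))))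

  next-surjective : ∀ {m} (j : Fin (suc m)) → ∃ λ i → next i ≡ j
  next-surjective {m} zero = fromℕ< (n<1+n m) , next-wrap _ (sym (toℕ-fromℕ< (n<1+n m)))
  next-surjective {m} (suc j) = inject₁ j , toℕ-injective (trans
    (next-step (inject₁ j) λ eq → <⇒≢ (toℕ<n j) (sym (trans eq (toℕ-inject₁ j))))
    (cong suc (toℕ-inject₁ j)))

  CycAdj⇒next : ∀ {m} (i j : Fin (suc m)) → CycAdj G (suc m) i j → next i ≡ j ⊎ next j ≡ i
  CycAdj⇒next i j (inj₁ p) = inj₁ (toℕ-injective (trans
    (next-step i λ eq → <-irrefl (trans (sym p) (cong suc (sym eq))) (toℕ<n j)) p))
  CycAdj⇒next i j (inj₂ (inj₁ p)) = inj₂ (toℕ-injective (trans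
    (next-step j λ eq → <-irrefl (trans (sym p) (cong suc (sym eq))) (toℕ<n i)) p))
  CycAdj⇒next i j (inj₂ (inj₂ (inj₁ (i≡0 , p)))) =
    inj₂ (trans (next-wrap j (sym (suc-injective p))) (toℕ-injective (sym i≡0)))
  CycAdj⇒next i j (inj₂ (inj₂ (inj₂ (j≡0 , p)))) =
    inj₁ (trans (next-wrap i (sym (suc-injective p))) (toℕ-injective (sym j≡0)))

  next⇒CycAdj : ∀ {m} (i : Fin (suc m)) → CycAdj G (suc m) i (next i) × CycAdj G (suc m) (next i) i
  next⇒CycAdj {m} i = case m ℕ.≟ toℕ i of λ where
    (yes p) → inj₂ (inj₂ (inj₂ (cong toℕ (next-wrap i p) , cong suc (sym p))))
            , inj₂ (inj₂ (inj₁ (cong toℕ (next-wrap i p) , cong suc (sym p))))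
    (no p) → inj₁ (sym (next-step i p)) , inj₂ (inj₁ (sym (next-step i p)))

  CycAdj-next⇒ : ∀ {m} (i j : Fin (suc m)) → CycAdj G (suc m) (next i) (next j) → CycAdj G (suc m) i j
  CycAdj-next⇒ i j c with CycAdj⇒next (next i) (next j) c
  ... | inj₁ p = subst (CycAdj G _ i) (next-injective _ _ p) (proj₁ (next⇒CycAdj i))
  ... | inj₂ p = subst (λ i → CycAdj G _ i j) (next-injective _ _ p) (proj₂ (next⇒CycAdj j))

  CycAdj-next⇐ : ∀ {m} (i j : Fin (suc m)) → CycAdj G (suc m) i j → CycAdj G (suc m) (next i) (next j)
  CycAdj-next⇐ i j c with CycAdj⇒next i j c
  ... | inj₁ refl = proj₁ (next⇒CycAdj (next i))
  ... | inj₂ refl = proj₂ (next⇒CycAdj (next j))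

  -- The vertices of H in cyclic order, starting from v.
  record Rooted (H : Hole G) (v : Vert) : Set where
    field
      m        : ℕ
      3≤m      : 3 ≤ m
      at       : Fin (suc m) → Vert
      at-inj   : ∀ i j → at i ≡ at j → i ≡ j
      at-adj⇒  : ∀ i j → Adj (at i) (at j) → CycAdj G (suc m) i j
      at-adj⇐  : ∀ i j → CycAdj G (suc m) i j → Adj (at i) (at j)
      sound    : ∀ i → at i ∈ₕ H
      complete : ∀ {w} → w ∈ₕ H → ∃ λ i → at i ≡ w
      root     : at zero ≡ v

  -- `CycAdj` is invariant under `next`, and each rotation lowers the position of the chosen vertex
  -- by one, so d rotations bring it to position zero.
  rotate : ∀ {H m} → 3 ≤ m → (at : Fin (suc m) → Vert) → (∀ i j → at i ≡ at j → i ≡ j) →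
           (∀ i j → (Adj (at i) (at j) → CycAdj G (suc m) i j) × (CycAdj G (suc m) i j → Adj (at i) (at j))) →
           (∀ i → at i ∈ₕ H) → (∀ {w} → w ∈ₕ H → ∃ λ i → at i ≡ w) →
           ∀ d i → toℕ i ≡ d → Rooted H (at i)
  rotate 3≤m at inj adj snd cmp zero zero eq = record
    { 3≤m = 3≤m ; at = at ; at-inj = inj ; at-adj⇒ = λ i j → proj₁ (adj i j) ; at-adj⇐ = λ i j → proj₂ (adj i j)
    ; sound = snd ; complete = cmp ; root = refl }
  rotate {H} {m} 3≤m at inj adj snd cmp (suc d) (suc i) eq =
    subst (λ j → Rooted H (at j)) next-i
      (rotate 3≤m (at ∘ next) (λ i j → next-injective i j ∘ inj _ _)
        (λ i j → CycAdj-next⇒ i j ∘ proj₁ (adj _ _) , proj₂ (adj _ _) ∘ CycAdj-next⇐ i j)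
        (snd ∘ next) cmp′ d (inject₁ i) (trans (toℕ-inject₁ i) (suc-injective eq)))
    where
    next-i : next (inject₁ i) ≡ suc i
    next-i = proj₂ (next-surjective (suc i))
    cmp′ : ∀ {w} → w ∈ₕ H → ∃ λ i → at (next i) ≡ w
    cmp′ w∈ with cmp w∈
    ... | j , refl with next-surjective j
    ... | k , refl = k , refl

  rooted : ∀ H {v} → v ∈ₕ H → Rooted H v
  rooted H@(record { len = suc m }) (i , refl) =
    rotate (≤-pred (len≥4 H)) (vtx H) (inj H) (induced H) (λ i → i , refl) id (toℕ i) i refl

  -- The vertex two steps after x works because a hole has length at least 4.
  far-vertex : ∀ H {x} → x ∈ₕ H → ∃ λ b → b ∈ₕ H × b ≢ x × ¬ Adj b x
  far-vertex H {x} x∈ with rooted H x∈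
  ... | record { m = suc (suc (suc m)) ; 3≤m = s≤s (s≤s (s≤s z≤n)) ; at = at
               ; at-inj = at-inj ; at-adj⇒ = at-adj⇒ ; sound = sound ; root = refl } =
    at two , sound two , (λ eq → case at-inj two zero eq of λ ()) , λ e → no-edge (at-adj⇒ two zero e)
    where
    two : Fin (4 + m)
    two = suc (suc zero)
    no-edge : ¬ CycAdj G (4 + m) two zero
    no-edge (inj₁ ())
    no-edge (inj₂ (inj₁ ()))
    no-edge (inj₂ (inj₂ (inj₁ (() , _))))
    no-edge (inj₂ (inj₂ (inj₂ (_ , ()))))

  -- One of the two components of H − {b, x}, for non-adjacent vertices b, x of a hole H.
  record Arc (H : Hole G) (b x : Vert) : Set₁ where
    field
      In       : Vert → Set
      p a      : Vert
      b~p      : Adj b p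
      x~a      : Adj x a
      p∈       : In p
      a∈       : In a
      In⊆      : ∀ {w} → In w → w ∈ₕ H
      walk     : ∀ {v w} → In v → In w → Walk In v w
      only-p   : ∀ {w} → In w → Adj b w → w ≡ p
      only-a   : ∀ {w} → In w → Adj x w → w ≡ a
      b∉       : ∀ {w} → In w → w ≢ b
      x∉       : ∀ {w} → In w → w ≢ x

  Apart : (P Q : Vert → Set) → Set
  Apart P Q = ∀ {v w} → P v → Q w → v ≢ w × ¬ Adj v w

  module _ {H : Hole G} {b x : Vert} (b∈ : b ∈ₕ H) (x∈ : x ∈ₕ H) (b≢x : b ≢ x) (b≁x : ¬ Adj b x) where
    private
      open Rooted (rooted H b∈)

      xAt : ∃ λ j → at j ≡ x
      xAt = complete x∈

      j : ℕ
      j = toℕ (proj₁ xAt)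

      j-at : ∀ {i} → at i ≡ x → toℕ i ≡ j
      j-at eq = cong toℕ (at-inj _ _ (trans eq (sym (proj₂ xAt))))

      j<1+m : j < suc m
      j<1+m = toℕ<n (proj₁ xAt)

      b~ : ∀ i → Adj b (at i) → CycAdj G (suc m) zero i
      b~ i e = at-adj⇒ zero i (subst (λ b → Adj b (at i)) (sym root) e)

      b~⇐ : ∀ i → CycAdj G (suc m) zero i → Adj b (at i)
      b~⇐ i c = subst (λ b → Adj b (at i)) root (at-adj⇐ zero i c)

      x~ : ∀ i → Adj x (at i) → CycAdj G (suc m) (proj₁ xAt) i
      x~ i e = at-adj⇒ _ i (subst (λ b → Adj b (at i)) (sym (proj₂ xAt)) e)

      x~⇐ : ∀ i → CycAdj G (suc m) (proj₁ xAt) i → Adj x (at i)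
      x~⇐ i c = subst (λ b → Adj b (at i)) (proj₂ xAt) (at-adj⇐ _ i c)

      b≁at : ∀ {i} → at i ≡ x → ¬ CycAdj G (suc m) zero i
      b≁at {i} eq c = b≁x (subst (Adj b) eq (b~⇐ i c))

      0<j : 0 < j
      0<j with proj₁ xAt in eq
      ... | zero  = contradiction (trans (sym root) (trans (cong at (sym eq)) (proj₂ xAt))) b≢x
      ... | suc _ = s≤s z≤n

      -- With b at position 0 and x at position j, non-adjacency excludes j = 1, and below also j =
      -- m; hence both arcs are nonempty.
      1<j : 1 < j
      1<j = ≤∧≢⇒< 0<j λ eq → b≁at (proj₂ xAt) (inj₁ eq)

      j<m : j < m
      j<m = ≤∧≢⇒< (≤-pred j<1+m) λ eq → b≁at (proj₂ xAt) (inj₂ (inj₂ (inj₁ (refl , cong suc eq))))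

      -- Half-open intervals of positions: the two arcs are `Seg 1 j` and `Seg (suc j) (suc m)`.
      Seg : ℕ → ℕ → Vert → Set
      Seg lo hi v = ∃ λ i → (lo ≤ toℕ i × toℕ i < hi) × at i ≡ v

      seg-walk : ∀ {lo hi} d i k → toℕ i + d ≡ toℕ k → lo ≤ toℕ i → toℕ k < hi → Walk (Seg lo hi) (at i) (at k)
      seg-walk zero i k eq lo≤ <hi with toℕ-injective {i = i} {j = k} (trans (sym (+-identityʳ _)) eq)
      ... | refl = end (i , (lo≤ , <hi) , refl)
      seg-walk {lo} {hi} (suc d) i k eq lo≤ <hi =
        ((i , (lo≤ , ≤-<-trans (<⇒≤ i<k) <hi) , refl) , at-adj⇐ i (next i) (proj₁ (next⇒CycAdj i)))
        ◅ seg-walk d (next i) k (trans (cong (_+ d) ni) eq′) (≤-trans lo≤ (≤-trans (<⇒≤ (n<1+n _)) (≤-reflexive (sym ni)))) <hi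
        where
        eq′ : suc (toℕ i) + d ≡ toℕ k
        eq′ = trans (sym (+-suc _ d)) eq
        i<k : toℕ i < toℕ k
        i<k = ≤-trans (m≤m+n (suc (toℕ i)) d) (≤-reflexive eq′)
        ni : toℕ (next i) ≡ suc (toℕ i)
        ni = next-step i λ eq → <-irrefl (sym eq) (<-≤-trans i<k (≤-pred (toℕ<n k)))

      walk-seg : ∀ {lo hi v w} → Seg lo hi v → Seg lo hi w → Walk (Seg lo hi) v w
      walk-seg (i , (p , q) , refl) (k , (r , s) , refl) with ℕ.≤-total (toℕ i) (toℕ k)
      ... | inj₁ le = seg-walk _ i k (m+[n∸m]≡n le) p s
      ... | inj₂ le = reverse (seg-walk _ k i (m+[n∸m]≡n le) r q)

      seg-b∉ : ∀ {lo hi w} → 0 < lo → Seg lo hi w → w ≢ b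
      seg-b∉ 0<lo (i , (p , _) , refl) eq with at-inj i zero (trans eq (sym root))
      ... | refl = contradiction (≤-trans 0<lo p) λ ()

      index : ∀ {lo hi} t → lo ≤ t → t < hi → t < suc m → Σ (Fin (suc m)) λ i → toℕ i ≡ t × Seg lo hi (at i)
      index {lo} {hi} t p q r = fromℕ< r , toℕ-fromℕ< r ,
        fromℕ< r , (subst (lo ≤_) (sym (toℕ-fromℕ< r)) p , subst (_< hi) (sym (toℕ-fromℕ< r)) q) , refl

      lower : Arc H b x
      lower = record
        { In = Seg 1 j ; p = _ ; a = _
        ; b~p = b~⇐ _ (inj₁ (sym (P .proj₂ .proj₁)))
        ; x~a = x~⇐ _ (inj₂ (inj₁ 1+A≡j))
        ; p∈ = P .proj₂ .proj₂ ; a∈ = A .proj₂ .proj₂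
        ; In⊆ = λ { (i , _ , refl) → sound i }
        ; walk = walk-seg
        ; only-p = λ { (i , s , refl) e → cong at (toℕ-injective (trans (lem i s (b~ i e)) (sym (P .proj₂ .proj₁)))) }
        ; only-a = λ { (i , s , refl) e → cong at (toℕ-injective (suc-injective (trans (lem′ i s (x~ i e)) (sym 1+A≡j)))) }
        ; b∉ = seg-b∉ ≤-refl
        ; x∉ = λ { (i , (_ , i<j) , refl) eq → <-irrefl (j-at eq) i<j } }
        where
        P : Σ (Fin (suc m)) λ i → toℕ i ≡ 1 × Seg 1 j (at i)
        P = index 1 ≤-refl 1<j (<-trans 1<j j<1+m)
        pred<j : ∀ {t} → 1 < t → suc (t ∸ 1) ≡ t
        pred<j (s≤s _) = refl
        A : Σ (Fin (suc m)) λ i → toℕ i ≡ j ∸ 1 × Seg 1 j (at i)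
        A = index (j ∸ 1) (≤-pred (subst (2 ≤_) (sym (pred<j 1<j)) 1<j)) (≤-reflexive (pred<j 1<j))
              (≤-trans (≤-reflexive (pred<j 1<j)) (<⇒≤ j<1+m))
        1+A≡j : suc (toℕ (A .proj₁)) ≡ j
        1+A≡j = trans (cong suc (A .proj₂ .proj₁)) (pred<j 1<j)
        lem : ∀ i → 1 ≤ toℕ i × toℕ i < j → CycAdj G (suc m) zero i → toℕ i ≡ 1
        lem i s (inj₁ eq) = sym eq
        lem i (_ , i<j) (inj₂ (inj₂ (inj₁ (_ , eq)))) = contradiction (<-trans i<j j<m) (<-irrefl (suc-injective eq))
        lem i (1≤i , _) (inj₂ (inj₂ (inj₂ (eq , _)))) = contradiction (subst (1 ≤_) eq 1≤i) λ ()
        lem′ : ∀ i → 1 ≤ toℕ i × toℕ i < j → CycAdj G (suc m) (proj₁ xAt) i → suc (toℕ i) ≡ j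
        lem′ i (_ , i<j) (inj₁ eq) = contradiction (≤-trans (≤-reflexive eq) (<⇒≤ i<j)) (n≮n _)
        lem′ i s (inj₂ (inj₁ eq)) = eq
        lem′ i s (inj₂ (inj₂ (inj₁ (eq , _)))) = contradiction 0<j (<-irrefl (sym eq))
        lem′ i (1≤i , _) (inj₂ (inj₂ (inj₂ (eq , _)))) = contradiction 1≤i (<-irrefl (sym eq))

      upper : Arc H b x
      upper = record
        { In = Seg (suc j) (suc m) ; p = _ ; a = _
        ; b~p = b~⇐ _ (inj₂ (inj₂ (inj₁ (refl , cong suc (P .proj₂ .proj₁)))))
        ; x~a = x~⇐ _ (inj₁ (sym (A .proj₂ .proj₁)))
        ; p∈ = P .proj₂ .proj₂ ; a∈ = A .proj₂ .proj₂
        ; In⊆ = λ { (i , _ , refl) → sound i }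
        ; walk = walk-seg
        ; only-p = λ { (i , s , refl) e → cong at (toℕ-injective (trans (lem i s (b~ i e)) (sym (P .proj₂ .proj₁)))) }
        ; only-a = λ { (i , s , refl) e → cong at (toℕ-injective (trans (lem′ i s (x~ i e)) (sym (A .proj₂ .proj₁)))) }
        ; b∉ = seg-b∉ (s≤s z≤n)
        ; x∉ = λ { (i , (j<i , _) , refl) eq → <-irrefl (sym (j-at eq)) j<i } }
        where
        -- Position 0 is b, so its neighbour on this arc is the last position m, across the
        -- wraparound.
        P : Σ (Fin (suc m)) λ i → toℕ i ≡ m × Seg (suc j) (suc m) (at i)
        P = index m j<m ≤-refl ≤-refl
        A : Σ (Fin (suc m)) λ i → toℕ i ≡ suc j × Seg (suc j) (suc m) (at i)
        A = index (suc j) ≤-refl (s≤s j<m) (s≤s j<m)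
        lem : ∀ i → suc j ≤ toℕ i × toℕ i < suc m → CycAdj G (suc m) zero i → toℕ i ≡ m
        lem i (j<i , _) (inj₁ eq) = contradiction (<-trans 1<j j<i) (<-irrefl eq)
        lem i _ (inj₂ (inj₂ (inj₁ (_ , eq)))) = suc-injective eq
        lem i (j<i , _) (inj₂ (inj₂ (inj₂ (eq , _)))) = contradiction (subst (suc j ≤_) eq j<i) λ ()
        lem′ : ∀ i → suc j ≤ toℕ i × toℕ i < suc m → CycAdj G (suc m) (proj₁ xAt) i → toℕ i ≡ suc j
        lem′ i _ (inj₁ eq) = sym eq
        lem′ i (j<i , _) (inj₂ (inj₁ eq)) = contradiction (≤-trans (≤-reflexive eq) (<⇒≤ j<i)) (n≮n _)
        lem′ i _ (inj₂ (inj₂ (inj₁ (eq , _)))) = contradiction 0<j (<-irrefl (sym eq))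
        lem′ i _ (inj₂ (inj₂ (inj₂ (_ , eq)))) = contradiction j<m (<-irrefl (suc-injective eq))

      lower-upper : Apart (Arc.In lower) (Arc.In upper)
      lower-upper (i , (1≤i , i<j) , refl) (k , (j<k , _) , refl) =
        (λ eq → <-irrefl (cong toℕ (at-inj i k eq)) i<k) , λ e → no-edge (at-adj⇒ i k e)
        where
        i<k : toℕ i < toℕ k
        i<k = <-trans i<j j<k
        no-edge : ¬ CycAdj G (suc m) i k
        no-edge (inj₁ eq) = <-irrefl eq (≤-<-trans i<j j<k)
        no-edge (inj₂ (inj₁ eq)) = <-irrefl refl (<-trans i<k (≤-reflexive eq))
        no-edge (inj₂ (inj₂ (inj₁ (eq , _)))) = <-irrefl (sym eq) 1≤i
        no-edge (inj₂ (inj₂ (inj₂ (eq , _)))) = <-irrefl (sym eq) (≤-<-trans z≤n i<k)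

    arcs : Σ (Arc H b x) λ A₁ → Σ (Arc H b x) λ A₂ → Apart (Arc.In A₁) (Arc.In A₂)
    arcs = lower , upper , lower-upper

-- Hole covers with the NC property

module NC (G : Graph) (X : V G → Set) (setNC : SetNC G X) where
  open Holes G

  unique-X : ∀ H {x y} → X x → X y → x ∈ₕ H → y ∈ₕ H → x ≡ y
  unique-X H Xx Xy (i , refl) (j , refl) = cong (vtx H) (proj₂ setNC H i j Xx Xy)

  -- The NC property of x in positive form. Holes are induced, so adjacent vertices common to H and
  -- K span a common edge, and it suffices to name the three vertices p, u, q.
  share : ∀ H K {x p u q} → X x → x ∈ₕ H → p ∈ₕ H → u ∈ₕ H → q ∈ₕ H → p ∈ₕ K → u ∈ₕ K → q ∈ₕ K →
          Adj p u → Adj u q → p ≢ q → x ∈ₕ K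
  share H K Xx x∈ p∈ u∈ q∈ p∈′ u∈′ q∈′ pu uq p≢q = decidable-stable (_ ∈ₕ? K) λ x∉ →
    proj₁ setNC _ Xx H K x∈ x∉ (_ , _ , _ , p≢q , hole-edge H p∈ u∈ pu , hole-edge H u∈ q∈ uq
                                        , hole-edge K p∈′ u∈′ pu , hole-edge K u∈′ q∈′ uq)

  HoleIn : (Vert → Set) → Hole G → Set
  HoleIn A H = ∀ {w} → w ∈ₕ H → A w

  -- Membership of b in U, the union of the holes in A through x.
  Cohole : (Vert → Set) → Vert → Vert → Set
  Cohole A x b = Σ (Hole G) λ H → HoleIn A H × x ∈ₕ H × b ∈ₕ H

  hole-in : ∀ {A R : Vert → Set} {v a b} → A v → (∀ {w} → R w → A w) → (T : HoleThrough R v a b) →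
            HoleIn A (HoleThrough.hole T)
  hole-in Av RA T w∈ = [ (λ { refl → Av }) , RA ]′ (HoleThrough.within T w∈)

  -- Attaches to every vertex of the walk a walk from s that reaches it, so that each vertex carries
  -- its own proof of lying in the component of s.
  trail : ∀ {Q : Vert → Set} {s a b} → Walk Q s a → Walk Q a b → Walk (λ v → Q v × Walk Q s v) a b
  trail w (end q)         = end (q , w)
  trail w ((q , e) ◅ w′) = ((q , w) , e) ◅ trail (w ▻ (e , source w′)) w′

  module Split {A : Vert → Set} {H : Hole G} {x b : Vert} (Xx : X x) (HA : HoleIn A H) (x∈ : x ∈ₕ H) (b∈ : b ∈ₕ H)
               (b≢x : b ≢ x) (b≁x : ¬ Adj b x) where
    open Arc

    -- The set A - x - N[b]; `Walk Free e` is the component of e in it.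
    Free : Vert → Set
    Free w = A w × w ≢ x × w ≢ b × ¬ Adj b w

    Attached : Vert → Vert → Set
    Attached e p = ∃ λ w → Adj p w × Walk Free e w

    -- Otherwise a hole would avoid x while sharing with H the two edges at b.
    not-both : ∀ {e} (A₁ A₂ : Arc H b x) → Apart (In A₁) (In A₂) → Attached e (p A₁) → Attached e (p A₂) → ⊥
    not-both A₁ A₂ ap (w₁ , e₁ , W₁) (w₂ , e₂ , W₂) =
      x∉K (share H K Xx x∈ (In⊆ A₁ (p∈ A₁)) b∈ (In⊆ A₂ (p∈ A₂)) left∈ apex∈ right∈ (adj-sym (b~p A₁)) (b~p A₂) p≢p)
      where
      p≢p : p A₁ ≢ p A₂
      p≢p = ap (p∈ A₁) (p∈ A₂) .proj₁
      R : Vert → Set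
      R w = w ≡ p A₁ ⊎ w ≡ p A₂ ⊎ Free w
      avoids : ∀ {w} → R w → w ≢ b × (Adj b w → w ≡ p A₁ ⊎ w ≡ p A₂)
      avoids (inj₁ refl) = b∉ A₁ (p∈ A₁) , λ _ → inj₁ refl
      avoids (inj₂ (inj₁ refl)) = b∉ A₂ (p∈ A₂) , λ _ → inj₂ refl
      avoids (inj₂ (inj₂ (_ , _ , w≢b , b≁w))) = w≢b , λ e → contradiction e b≁w
      W : Walk R (p A₁) (p A₂)
      W = (inj₁ refl , e₁) ◅ (mapW (inj₂ ∘ inj₂) (reverse W₁ ++ W₂) ▻ (adj-sym e₂ , inj₂ (inj₁ refl)))
      T : HoleThrough R b (p A₁) (p A₂)
      T = hole-through (b~p A₁) (b~p A₂) p≢p (ap (p∈ A₁) (p∈ A₂) .proj₂) avoids W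
      open HoleThrough T renaming (hole to K)
      x∉K : ¬ x ∈ₕ K
      x∉K x∈K with within x∈K
      ... | inj₁ x≡b = b≢x (sym x≡b)
      ... | inj₂ (inj₁ eq) = x∉ A₁ (p∈ A₁) (sym eq)
      ... | inj₂ (inj₂ (inj₁ eq)) = x∉ A₂ (p∈ A₂) (sym eq)
      ... | inj₂ (inj₂ (inj₂ (_ , x≢x , _))) = x≢x refl

    -- Every vertex of the arc except its end p is `Free`, since b sees only p. A contact with the
    -- component of e would therefore spread along the arc until it reached p.
    apart : ∀ {e} (A₁ : Arc H b x) → ¬ Attached e (p A₁) → Apart (In A₁) (Walk Free e)
    apart {e} A₁ ¬att {w} {v} w∈ W = w≢v , w≁v
      where
      attach : ∀ {u} → Walk Free e u → Walk (In A₁) u (p A₁) → ⊥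
      attach V (end _) = target V .proj₂ .proj₂ .proj₂ (b~p A₁)
      attach V (_◅_ {b = u′} (_ , uv) Z) with source Z | u′ ≟F p A₁
      ... | u∈ | yes refl = ¬att (_ , adj-sym uv , V)
      ... | u∈ | no u≢p = attach (V ▻ (uv , HA (In⊆ A₁ u∈) , x∉ A₁ u∈ , b∉ A₁ u∈ , u≢p ∘ only-p A₁ u∈)) Z
      w≢v : w ≢ v
      w≢v refl = attach W (walk A₁ w∈ (p∈ A₁))
      w≁v : ¬ Adj w v
      w≁v wv with w ≟F p A₁
      ... | yes refl = ¬att (_ , wv , W)
      ... | no w≢p = attach (W ▻ (adj-sym wv , HA (In⊆ A₁ w∈) , x∉ A₁ w∈ , b∉ A₁ w∈ , w≢p ∘ only-p A₁ w∈))
                            (walk A₁ w∈ (p∈ A₁))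

    -- By `not-both`, the component of e is not attached to the end p of one of the arcs, and
    -- `apart` clears that arc. Since A is an arbitrary predicate, attachment is not decided, hence
    -- the double negation.
    clear-arc : ∀ e → ¬ ¬ (Σ (Arc H b x) λ A₁ → Apart (In A₁) (Walk Free e))
    clear-arc e k with arcs b∈ x∈ b≢x b≁x
    ... | A₁ , A₂ , ap = k (A₁ , apart A₁ λ att₁ → k (A₂ , apart A₂ λ att₂ → not-both A₁ A₂ ap att₁ att₂))

    -- One arc of H is apart from the walk from r to e, so it closes the walk to a hole through x, and
    -- this hole can leave the walk only at d.
    detour : ∀ {d r e} → A d → d ≢ x → ¬ Adj x d → Adj b d → Adj d r →
             Walk (λ w → Free w × (Adj x w → w ≡ e)) r e → Adj x e → ¬ ¬ Cohole A x d
    detour {d} {r} {e} Ad d≢x x≁d bd dr ρ xe k = clear-arc e go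
      where
      E : Vert → Set
      E = Walk Free e
      go : ¬ (Σ (Arc H b x) λ A₁ → Apart (In A₁) E)
      go (A₁ , ap) = k (K , hole-in (HA x∈) RA T , apex∈ , decidable-stable (d ∈ₕ? K) d∈)
        where
        R : Vert → Set
        R w = (E w × (Adj x w → w ≡ e)) ⊎ w ≡ d ⊎ w ≡ b ⊎ In A₁ w
        Ee : E e
        Ee = end (target ρ .proj₁)
        avoids : ∀ {w} → R w → w ≢ x × (Adj x w → w ≡ e ⊎ w ≡ a A₁)
        avoids (inj₁ (W , f)) = target W .proj₂ .proj₁ , inj₁ ∘ f
        avoids (inj₂ (inj₁ refl)) = d≢x , λ xd → contradiction xd x≁d
        avoids (inj₂ (inj₂ (inj₁ refl))) = b≢x , λ xb → contradiction (adj-sym xb) b≁x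
        avoids (inj₂ (inj₂ (inj₂ w∈))) = x∉ A₁ w∈ , inj₂ ∘ only-a A₁ w∈
        RA : ∀ {w} → R w → A w
        RA (inj₁ (W , _)) = target W .proj₁
        RA (inj₂ (inj₁ refl)) = Ad
        RA (inj₂ (inj₂ (inj₁ refl))) = HA b∈
        RA (inj₂ (inj₂ (inj₂ w∈))) = HA (In⊆ A₁ w∈)
        back : Walk R e r
        back = mapW (λ { ((_ , f) , W) → inj₁ (mapW proj₁ W , f) }) (trail (end (target ρ)) (reverse ρ))
        W : Walk R e (a A₁)
        W = back ++[ adj-sym dr ] ((inj₂ (inj₁ refl) , adj-sym bd) ◅ ((inj₂ (inj₂ (inj₁ refl)) , b~p A₁) ◅
              mapW (inj₂ ∘ inj₂ ∘ inj₂) (walk A₁ (p∈ A₁) (a∈ A₁))))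
        e≁a : ¬ Adj e (a A₁)
        e≁a ea = ap (a∈ A₁) Ee .proj₂ (adj-sym ea)
        T : HoleThrough R x e (a A₁)
        T = hole-through xe (x~a A₁) (λ eq → ap (a∈ A₁) Ee .proj₁ (sym eq)) e≁a avoids W
        open HoleThrough T renaming (hole to K)
        -- The induced path may shortcut `W`. Were d skipped, the rim could never leave `E`: b has
        -- no neighbour there and the arc is apart from it. But the rim ends on the arc.
        d∈ : ¬ ¬ d ∈ₕ K
        d∈ d∉ = ap (a∈ A₁) (walk-invariant {Q = E} keep Ee rim) .proj₁ refl
          where
          keep : ∀ {u v} → E u → R u × u ∈ₕ K → R v × v ∈ₕ K → Adj u v → E v
          keep Eu _ (inj₁ (Ev , _) , _) uv = Ev
          keep Eu _ (inj₂ (inj₁ refl) , v∈) uv = contradiction v∈ d∉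
          keep Eu _ (inj₂ (inj₂ (inj₁ refl)) , _) uv = contradiction (adj-sym uv) (target Eu .proj₂ .proj₂ .proj₂)
          keep Eu _ (inj₂ (inj₂ (inj₂ v∈)) , _) uv = contradiction (adj-sym uv) (ap v∈ Eu .proj₂)

  -- Cuts the walk after its last neighbour d of b, so that the remainder avoids N(b) as `detour`
  -- requires.
  last-neighbour : ∀ {P : Vert → Set} {b s t} → Walk P s t → Adj b s → ¬ Adj b t →
                   ∃₂ λ d r → P d × Adj b d × Adj d r × Walk (λ w → P w × ¬ Adj b w) r t
  last-neighbour {P} {b} w bs b≁t with scan w b≁t
    where
    scan : ∀ {s t} → Walk P s t → ¬ Adj b t → Walk (λ w → P w × ¬ Adj b w) s t ⊎
           ∃₂ λ d r → P d × Adj b d × Adj d r × Walk (λ w → P w × ¬ Adj b w) r t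
    scan (end p) b≁t = inj₁ (end (p , b≁t))
    scan {s} ((p , e) ◅ w) b≁t with scan w b≁t | adj? b s
    ... | inj₂ found | _ = inj₂ found
    ... | inj₁ w′ | yes bs = inj₂ (_ , _ , p , bs , e , w′)
    ... | inj₁ w′ | no b≁s = inj₁ ((((p , b≁s)) , e) ◅ w′)
  ... | inj₁ w′ = contradiction bs (source w′ .proj₂)
  ... | inj₂ found = found

  -- A component of A − N[x] − U is attached to a clique, where U is the union of the holes through x.
  module Component {A : Vert → Set} {x d₀ : Vert} (Xx : X x) (Ax : A x) where
    open Arc

    Out : Vert → Set
    Out w = A w × w ≢ x × ¬ Adj x w × ¬ Cohole A x w

    D : Vert → Set
    D = Walk Out d₀

    Border : Vert → Set
    Border s = A s × ¬ D s × ∃ λ d → D d × Adj s d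

    out-walk : ∀ {d d′} → D d → D d′ → Walk Out d d′
    out-walk W W′ = reverse W ++ W′

    module _ {b : Vert} (Ub : Cohole A x b) (b≢x : b ≢ x) (b≁x : ¬ Adj b x) where
      open Split {A} {Ub .proj₁} Xx (Ub .proj₂ .proj₁) (Ub .proj₂ .proj₂ .proj₁) (Ub .proj₂ .proj₂ .proj₂) b≢x b≁x using (detour)

      -- The last neighbour of b on the walk lies in `Out`, hence off U, whereas `detour` places it
      -- on a hole through x.
      no-exit : ∀ {P : Vert → Set} {s e} → Adj b s → Walk P s e → Adj x e → ¬ Adj b e →
                (∀ {w} → P w → A w × w ≢ x × w ≢ b × (Adj x w → w ≡ e) × (Adj b w → Out w)) → ⊥
      no-exit bs W xe b≁e f with last-neighbour W bs b≁e
      ... | d , r , Pd , bd , dr , ρ with f Pd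
      ... | Ad , d≢x , _ , _ , out with out bd
      ... | _ , _ , x≁d , ¬Ud = detour Ad d≢x x≁d bd dr (mapW g ρ) xe ¬Ud
        where
        g : ∀ {w} → _ × ¬ Adj b w → (A w × w ≢ x × w ≢ b × ¬ Adj b w) × (Adj x w → w ≡ _)
        g (Pw , b≁w) with f Pw
        ... | Aw , w≢x , w≢b , fx , _ = (Aw , w≢x , w≢b , b≁w) , fx

      out≢b : ∀ {w} → Out w → w ≢ b
      out≢b (_ , _ , _ , ¬U) refl = ¬U Ub

      -- If b and e were non-adjacent, crossing the component from b to e, a neighbour of x, would
      -- be a walk forbidden by `no-exit`.
      border-mixed : ∀ {e d d′} → Adj b d → D d → D d′ → Adj e d′ → Adj x e → A e → b ≢ e → Adj b e
      border-mixed {e} bd Dd Dd′ ed′ xe Ae b≢e = decidable-stable (adj? b e) λ b≁e →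
        no-exit {λ w → Out w ⊎ w ≡ e} bd (mapW inj₁ (out-walk Dd Dd′) ▻ (adj-sym ed′ , inj₂ refl)) xe b≁e λ
          { (inj₁ o@(Aw , w≢x , x≁w , _)) → Aw , w≢x , out≢b o , (λ xw → contradiction xw x≁w) , λ _ → o
          ; (inj₂ refl) → Ae , (λ { refl → irrefl xe }) , b≢e ∘ sym , (λ _ → refl) , λ be → contradiction be b≁e }

      module _ {b′ : Vert} (Ub′ : Cohole A x b′) (b′≢x : b′ ≢ x) (b′≁x : ¬ Adj b′ x)
               (b≢b′ : b ≢ b′) (b≁b′ : ¬ Adj b b′) where
        private
          H′ = Ub′ .proj₁
          HA′ : HoleIn A H′
          HA′ = Ub′ .proj₂ .proj₁
          x∈′ = Ub′ .proj₂ .proj₂ .proj₁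
          b′∈ = Ub′ .proj₂ .proj₂ .proj₂

        -- Here the forbidden walk crosses the component to b′ and continues along C to the
        -- neighbour of x at its end. So b must be near some vertex of C.
        along-arc : ∀ {d d′} → Adj b d → D d → D d′ → Adj b′ d′ → (C : Arc H′ b′ x) →
                    (∀ {w} → In C w → Near b w → ⊥) → ⊥
        along-arc bd Dd Dd′ b′d′ C far =
          no-exit {λ w → Out w ⊎ w ≡ b′ ⊎ In C w} bd (mapW inj₁ (out-walk Dd Dd′) ++[ adj-sym b′d′ ]
            ((inj₂ (inj₁ refl) , b~p C) ◅ mapW (inj₂ ∘ inj₂) (walk C (p∈ C) (a∈ C)))) (x~a C) (far (a∈ C) ∘ inj₂) λ
          { (inj₁ o@(Aw , w≢x , x≁w , _)) → Aw , w≢x , out≢b o , (λ xw → contradiction xw x≁w) , λ _ → o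
          ; (inj₂ (inj₁ refl)) → HA′ b′∈ , b′≢x , b≢b′ ∘ sym , (λ xb′ → contradiction (adj-sym xb′) b′≁x)
                               , λ bb′ → contradiction bb′ b≁b′
          ; (inj₂ (inj₂ w∈)) → HA′ (In⊆ C w∈) , x∉ C w∈ , (λ { refl → far w∈ (inj₁ refl) }) , only-a C w∈
                             , λ bw → ⊥-elim (far w∈ (inj₂ bw)) }

        -- If b is adjacent to both arcs of the hole through b′ and x, then the hole through b and b′
        -- avoids x but shares with the former the two edges at b′.
        between-arcs : (C₁ C₂ : Arc H′ b′ x) → Apart (In C₁) (In C₂) → ∀ {s₁ s₂} →
                       In C₁ s₁ → Near b s₁ → In C₂ s₂ → Near b s₂ → ⊥
        between-arcs C₁ C₂ ap s₁∈ (inj₁ refl) s₂∈ (inj₁ refl) = ap s₁∈ s₂∈ .proj₁ refl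
        between-arcs C₁ C₂ ap s₁∈ (inj₁ refl) s₂∈ (inj₂ e) = ap s₁∈ s₂∈ .proj₂ e
        between-arcs C₁ C₂ ap s₁∈ (inj₂ e) s₂∈ (inj₁ refl) = ap s₁∈ s₂∈ .proj₂ (adj-sym e)
        between-arcs C₁ C₂ ap s₁∈ (inj₂ e₁) s₂∈ (inj₂ e₂) =
          x∉K (share H′ K Xx x∈′ (In⊆ C₁ (p∈ C₁)) b′∈ (In⊆ C₂ (p∈ C₂)) left∈ apex∈ right∈ (adj-sym (b~p C₁)) (b~p C₂) p≢p)
          where
          p≢p : p C₁ ≢ p C₂
          p≢p = ap (p∈ C₁) (p∈ C₂) .proj₁
          R : Vert → Set
          R w = In C₁ w ⊎ w ≡ b ⊎ In C₂ w
          avoids : ∀ {w} → R w → w ≢ b′ × (Adj b′ w → w ≡ p C₁ ⊎ w ≡ p C₂)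
          avoids (inj₁ w∈) = b∉ C₁ w∈ , inj₁ ∘ only-p C₁ w∈
          avoids (inj₂ (inj₁ refl)) = b≢b′ , λ e → contradiction (adj-sym e) b≁b′
          avoids (inj₂ (inj₂ w∈)) = b∉ C₂ w∈ , inj₂ ∘ only-p C₂ w∈
          T : HoleThrough R b′ (p C₁) (p C₂)
          T = hole-through (b~p C₁) (b~p C₂) p≢p (ap (p∈ C₁) (p∈ C₂) .proj₂) avoids
                (mapW inj₁ (walk C₁ (p∈ C₁) s₁∈) ++[ adj-sym e₁ ] ((inj₂ (inj₁ refl) , e₂) ◅
                 mapW (inj₂ ∘ inj₂) (walk C₂ s₂∈ (p∈ C₂))))
          open HoleThrough T renaming (hole to K)
          x∉K : ¬ x ∈ₕ K
          x∉K x∈K with within x∈K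
          ... | inj₁ x≡b′ = b′≢x (sym x≡b′)
          ... | inj₂ (inj₁ x∈) = x∉ C₁ x∈ refl
          ... | inj₂ (inj₂ (inj₁ x≡b)) = b≢x (sym x≡b)
          ... | inj₂ (inj₂ (inj₂ x∈)) = x∉ C₂ x∈ refl

        -- By `along-arc`, b is near both arcs of the hole through b′ and x, which `between-arcs`
        -- refutes.
        border-far : ∀ {d d′} → Adj b d → D d → D d′ → Adj b′ d′ → ⊥
        border-far bd Dd Dd′ b′d′ with arcs b′∈ x∈′ b′≢x b′≁x
        ... | C₁ , C₂ , ap = along-arc bd Dd Dd′ b′d′ C₁ λ s₁∈ n₁ → along-arc bd Dd Dd′ b′d′ C₂ λ s₂∈ n₂ →
                             between-arcs C₁ C₂ ap s₁∈ n₁ s₂∈ n₂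

    -- Otherwise x together with a walk through the component gives a hole in A through x. Its rim
    -- vertex after s is in `Out`, although it lies on that hole and so in U.
    border-near : ∀ {s t d d′} → Adj x s → Adj x t → A s → A t → s ≢ t → D d → D d′ → Adj s d → Adj t d′ → Adj s t
    border-near {s} {t} {d} {d′} xs xt As At s≢t Dd Dd′ sd td′ = decidable-stable (adj? s t) λ s≁t → meets s≁t (T s≁t)
      where
      R : Vert → Set
      R w = w ≡ s ⊎ w ≡ t ⊎ Out w
      avoids : ∀ {w} → R w → w ≢ x × (Adj x w → w ≡ s ⊎ w ≡ t)
      avoids (inj₁ refl) = (λ { refl → irrefl xs }) , λ _ → inj₁ refl
      avoids (inj₂ (inj₁ refl)) = (λ { refl → irrefl xt }) , λ _ → inj₂ refl
      avoids (inj₂ (inj₂ (_ , w≢x , x≁w , _))) = w≢x , λ e → contradiction e x≁w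
      T : ¬ Adj s t → HoleThrough R x s t
      T s≁t = hole-through xs xt s≢t s≁t avoids
        ((inj₁ refl , sd) ◅ (mapW (inj₂ ∘ inj₂) (out-walk Dd Dd′) ▻ (adj-sym td′ , inj₂ (inj₁ refl))))
      meets : ¬ Adj s t → HoleThrough R x s t → ⊥
      meets s≁t T = second rim
        where
        open HoleThrough T
        second : ¬ Walk (λ w → R w × w ∈ₕ hole) s t
        second (end _) = s≢t refl
        second ((_ , e) ◅ w) with source w
        ... | inj₁ refl , _ = irrefl e
        ... | inj₂ (inj₁ refl) , _ = s≁t e
        ... | inj₂ (inj₂ (_ , _ , _ , ¬U)) , w∈ = ¬U (hole , hole-in Ax
              (λ { (inj₁ refl) → As ; (inj₂ (inj₁ refl)) → At ; (inj₂ (inj₂ (Aw , _))) → Aw }) T , apex∈ , w∈)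

    x∉border : ∀ {s} → Border s → s ≢ x
    x∉border (_ , _ , d , Dd , sd) refl = target Dd .proj₂ .proj₂ .proj₁ sd

    -- Off U, the vertex s would satisfy `Out` and so belong to the component it borders.
    border-cohole : ∀ {s} → Border s → ¬ Adj x s → ¬ ¬ Cohole A x s
    border-cohole B@(As , ¬Ds , d , Dd , sd) x≁s ¬U = ¬Ds (Dd ▻ (adj-sym sd , As , x∉border B , x≁s , ¬U))

    border-clique : ∀ {s t} → Border s → Border t → s ≢ t → Adj s t
    border-clique {s} {t} Bs@(As , _ , d , Dd , sd) Bt@(At , _ , d′ , Dd′ , td′) s≢t with adj? x s | adj? x t
    ... | yes xs | yes xt = border-near xs xt As At s≢t Dd Dd′ sd td′
    ... | no x≁s | yes xt = decidable-stable (adj? s t) λ s≁t → border-cohole Bs x≁s λ Us →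
          s≁t (border-mixed Us (x∉border Bs) (x≁s ∘ adj-sym) sd Dd Dd′ td′ xt At s≢t)
    ... | yes xs | no x≁t = decidable-stable (adj? s t) λ s≁t → border-cohole Bt x≁t λ Ut →
          s≁t (adj-sym (border-mixed Ut (x∉border Bt) (x≁t ∘ adj-sym) td′ Dd′ Dd sd xs As (s≢t ∘ sym)))
    ... | no x≁s | no x≁t = decidable-stable (adj? s t) λ s≁t → border-cohole Bs x≁s λ Us → border-cohole Bt x≁t λ Ut →
          border-far Us (x∉border Bs) (x≁s ∘ adj-sym) Ut (x∉border Bt) (x≁t ∘ adj-sym) s≢t s≁t sd Dd Dd′ td′

  -- An arc of H clear of y and an arc of K clear of x meet at b. Closed up by the edge xy they
  -- yield a hole through both x and y, but a hole holds at most one vertex of X.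
  no-common-far : ∀ {A x y b} → X x → X y → x ≢ y → Adj x y → b ≢ x → b ≢ y → ¬ Adj b x → ¬ Adj b y →
                  Cohole A x b → Cohole A y b → ⊥
  no-common-far {A} {x} {y} {b} Xx Xy x≢y xy b≢x b≢y b≁x b≁y (H , HA , x∈ , b∈) (K , KA , y∈ , b∈′) =
    Sx.clear-arc y λ (C , apC) → Sy.clear-arc x λ (C′ , apC′) → contra C apC C′ apC′
    where
    module Sx = Split {A} {H} {x} {b} Xx HA x∈ b∈ b≢x b≁x
    module Sy = Split {A} {K} {y} {b} Xy KA y∈ b∈′ b≢y b≁y
    open Arc
    Ey : Walk Sx.Free y y
    Ey = end (KA y∈ , x≢y ∘ sym , b≢y ∘ sym , b≁y)
    Ex : Walk Sy.Free x x
    Ex = end (HA x∈ , x≢y , b≢x ∘ sym , b≁x)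
    contra : (C : Arc H b x) → Apart (In C) (Walk Sx.Free y) → (C′ : Arc K b y) → Apart (In C′) (Walk Sy.Free x) → ⊥
    contra C apC C′ apC′ = x≢y (unique-X hole Xx Xy apex∈ left∈)
      where
      R : Vert → Set
      R w = w ≡ y ⊎ In C′ w ⊎ w ≡ b ⊎ In C w
      avoids : ∀ {w} → R w → w ≢ x × (Adj x w → w ≡ y ⊎ w ≡ a C)
      avoids (inj₁ refl) = x≢y ∘ sym , λ _ → inj₁ refl
      avoids (inj₂ (inj₁ w∈)) = apC′ w∈ Ex .proj₁ , λ xw → contradiction (adj-sym xw) (apC′ w∈ Ex .proj₂)
      avoids (inj₂ (inj₂ (inj₁ refl))) = b≢x , λ xb → contradiction (adj-sym xb) b≁x
      avoids (inj₂ (inj₂ (inj₂ w∈))) = x∉ C w∈ , inj₂ ∘ only-a C w∈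
      T : HoleThrough R x y (a C)
      T = hole-through xy (x~a C) (λ eq → apC (a∈ C) Ey .proj₁ (sym eq)) (λ e → apC (a∈ C) Ey .proj₂ (adj-sym e)) avoids
            ((inj₁ refl , x~a C′) ◅ (mapW (inj₂ ∘ inj₁) (walk C′ (a∈ C′) (p∈ C′)) ++[ adj-sym (b~p C′) ]
              ((inj₂ (inj₂ (inj₁ refl)) , b~p C) ◅ mapW (inj₂ ∘ inj₂ ∘ inj₂) (walk C (p∈ C) (a∈ C)))))
      open HoleThrough T

  -- The vertices x, c, b, y induce a 4-cycle, a hole with two vertices of X.
  no-square : ∀ {x y b c} → X x → X y → x ≢ y → Adj x c → Adj c b → Adj b y → Adj y x → x ≢ b → c ≢ y →
              ¬ Adj x b → ¬ Adj c y → ⊥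
  no-square {x} {y} {b} {c} Xx Xy x≢y xc cb by yx x≢b c≢y x≁b c≁y = second rim
    where
    R : Vert → Set
    R w = w ≡ x ⊎ w ≡ y ⊎ w ≡ b
    avoids : ∀ {w} → R w → w ≢ c × (Adj c w → w ≡ x ⊎ w ≡ b)
    avoids (inj₁ refl) = (λ { refl → irrefl xc }) , λ _ → inj₁ refl
    avoids (inj₂ (inj₁ refl)) = c≢y ∘ sym , λ cy → contradiction cy c≁y
    avoids (inj₂ (inj₂ refl)) = (λ { refl → irrefl cb }) , λ _ → inj₂ refl
    T : HoleThrough R c x b
    T = hole-through (adj-sym xc) cb x≢b x≁b avoids
          ((inj₁ refl , adj-sym yx) ◅ ((inj₂ (inj₁ refl) , adj-sym by) ◅ end (inj₂ (inj₂ refl))))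
    open HoleThrough T
    second : ¬ Walk (λ w → R w × w ∈ₕ hole) x b
    second (end _) = x≢b refl
    second ((_ , e) ◅ w) with source w
    ... | inj₁ refl , _ = irrefl e
    ... | inj₂ (inj₁ refl) , y∈ = x≢y (unique-X hole Xx Xy left∈ y∈)
    ... | inj₂ (inj₂ refl) , _ = x≁b e

-- Finite subsets cut out by predicates

-- Lets a proof of a negation treat arbitrary predicates, such as X or membership in a component, as
-- subsets with a cardinality.
¬¬-decidable : ∀ {n} (P : Fin n → Set) → ¬ ¬ (∀ i → Dec (P i))
¬¬-decidable {zero}  P k = k λ ()
¬¬-decidable {suc n} P k = ¬¬-excluded-middle λ P0? → ¬¬-decidable (P ∘ suc) λ P? →
  k λ { zero → P0? ; (suc i) → P? i }

module _ {n : ℕ} {P : Fin n → Set} where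
  ⟦_⟧ : (∀ i → Dec (P i)) → Subset n
  ⟦ P? ⟧ = tabulate (does ∘ P?)

  ∈⟦⟧⁺ : ∀ (P? : ∀ i → Dec (P i)) {i} → P i → i ∈ ⟦ P? ⟧
  ∈⟦⟧⁺ P? {i} Pi = lookup⇒[]= i _ (trans (lookup∘tabulate (does ∘ P?) i) (dec-true (P? i) Pi))

  ∈⟦⟧⁻ : ∀ (P? : ∀ i → Dec (P i)) {i} → i ∈ ⟦ P? ⟧ → P i
  ∈⟦⟧⁻ P? {i} i∈ with P? i | trans (sym (lookup∘tabulate (does ∘ P?) i)) ([]=⇒lookup i∈)
  ... | yes Pi | _ = Pi
  ... | no _   | ()

-- Clique separators

module Separations (G : Graph) where
  open Holes G

  Clique : (Vert → Set) → Set
  Clique S = ∀ {s t} → S s → S t → s ≢ t → Adj s t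

  -- W is one side, `Border` the separating clique, and a lies beyond it. The border may be empty,
  -- so a disconnected A is covered too.
  record Separation (A : Subset n) : Set₁ where
    field
      W      : Vert → Set
      {w₀}   : Vert
      w₀∈W   : W w₀
      W⊆A    : ∀ {w} → W w → w ∈ A
      {a}    : Vert
      a∈A    : a ∈ A
      a∉W    : ¬ W a
      a≁W    : ∀ {w} → W w → ¬ Adj a w
    Border : Vert → Set
    Border s = s ∈ A × ¬ W s × ∃ λ w → W w × Adj s w
    field
      clique : Clique Border

  Outside : (Vert → Set) → Subset n → Set
  Outside S A = ∃ λ u → u ∈ A × ¬ S u

  -- A clique cannot meet both sides of a clique separation, so the wanted vertex can be looked for on
  -- a side that it misses, with the separator as the new forbidden clique.
  separation-induction :
    (P : Subset n → Set) (Q : Subset n → Vert → Set) →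
    (∀ {A A′} → A′ ⊆ A → P A → P A′) →
    (∀ {A A′ v} → A′ ⊆ A → (∀ {u} → u ∈ A → Adj v u → u ∈ A′) → Q A′ v → Q A v) →
    (∀ A S → P A → Clique S → Outside S A → ¬ Separation A → ¬ ¬ ∃ λ v → v ∈ A × ¬ S v × Q A v) →
    ∀ A S → P A → Clique S → Outside S A → ¬ ¬ ∃ λ v → v ∈ A × ¬ S v × Q A v
  separation-induction P Q hereditary local base A S PA = go _ A S PA ≤-refl
    where
    go : ∀ m A S → P A → ∣ A ∣ < m → Clique S → Outside S A → ¬ ¬ ∃ λ v → v ∈ A × ¬ S v × Q A v
    go (suc m) A S PA (s≤s ∣A∣≤m) clS out k = base A S PA clS out split k
      where
      split : ¬ Separation A
      split sep = ¬¬-decidable W λ W? → sides W? (λ w → any? λ v → W? v ×-dec adj? w v)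
        where
        open Separation sep
        Att : Vert → Set
        Att u = ∃ λ w → W w × Adj u w
        sides : (∀ u → Dec (W u)) → (∀ u → Dec (Att u)) → ⊥
        sides W? Att? = side₁ λ Ww Sw → side₂ λ ¬Wu ¬att Su →
          ¬att (_ , Ww , clS Su Sw λ { refl → ¬Wu Ww })
          where
          -- Both sides keep the border. The first loses a and the second loses w₀, so both are
          -- smaller than A; off the border, a vertex has all its A-neighbours on its own side.
          A₁? : ∀ u → Dec (u ∈ A × (W u ⊎ Att u))
          A₁? u = u ∈? A ×-dec (W? u ⊎-dec Att? u)
          A₂? : ∀ u → Dec (u ∈ A × ¬ W u)
          A₂? u = u ∈? A ×-dec ¬? (W? u)
          A₁⊆A : ⟦ A₁? ⟧ ⊆ A
          A₁⊆A = proj₁ ∘ ∈⟦⟧⁻ A₁?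
          A₂⊆A : ⟦ A₂? ⟧ ⊆ A
          A₂⊆A = proj₁ ∘ ∈⟦⟧⁻ A₂?
          A₁< : ∣ ⟦ A₁? ⟧ ∣ < m
          A₁< = <-≤-trans (p⊂q⇒∣p∣<∣q∣ (A₁⊆A , a , a∈A , λ a∈ →
            [ a∉W , (λ (_ , Ww , aw) → a≁W Ww aw) ]′ (∈⟦⟧⁻ A₁? a∈ .proj₂))) ∣A∣≤m
          A₂< : ∣ ⟦ A₂? ⟧ ∣ < m
          A₂< = <-≤-trans (p⊂q⇒∣p∣<∣q∣ (A₂⊆A , w₀ , W⊆A w₀∈W , λ w₀∈ → ∈⟦⟧⁻ A₂? w₀∈ .proj₂ w₀∈W)) ∣A∣≤m
          side₁ : (∀ {w} → W w → ¬ S w) → ⊥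
          side₁ miss = go m ⟦ A₁? ⟧ Border (hereditary A₁⊆A PA) A₁< clique
            (w₀ , ∈⟦⟧⁺ A₁? (W⊆A w₀∈W , inj₁ w₀∈W) , λ (_ , ¬W , _) → ¬W w₀∈W)
            λ (v , v∈ , ¬B , q) → let Wv = inW v∈ ¬B in
              k (v , A₁⊆A v∈ , miss Wv , local A₁⊆A (λ u∈ vu → ∈⟦⟧⁺ A₁? (u∈ , inj₂ (v , Wv , adj-sym vu))) q)
            where
            inW : ∀ {v} → v ∈ ⟦ A₁? ⟧ → ¬ Border v → W v
            inW {v} v∈ ¬B with W? v | ∈⟦⟧⁻ A₁? v∈
            ... | yes Wv | _ = Wv
            ... | no ¬Wv | _ , inj₁ Wv = Wv
            ... | no ¬Wv | v∈A , inj₂ att = contradiction (v∈A , ¬Wv , att) ¬B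
          side₂ : (∀ {u} → ¬ W u → ¬ Att u → ¬ S u) → ⊥
          side₂ miss = go m ⟦ A₂? ⟧ Border (hereditary A₂⊆A PA) A₂< clique
            (a , ∈⟦⟧⁺ A₂? (a∈A , a∉W) , λ (_ , _ , _ , Ww , aw) → a≁W Ww aw)
            λ (v , v∈ , ¬B , q) →
              let v∈A , ¬Wv = ∈⟦⟧⁻ A₂? v∈
                  ¬att = λ att → ¬B (v∈A , ¬Wv , att)
              in k (v , v∈A , miss ¬Wv ¬att ,
                    local A₂⊆A (λ {u} u∈ vu → ∈⟦⟧⁺ A₂? (u∈ , λ Wu → ¬att (u , Wu , vu))) q)

  -- Simplicial vertices of chordal graphs

  Simplicial : Subset n → Vert → Set
  Simplicial A v = Clique λ s → s ∈ A × Adj v s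

  HoleFree : Subset n → Set
  HoleFree A = (H : Hole G) → ¬ (∀ {w} → w ∈ₕ H → w ∈ A)

  -- Dirac's theorem relative to a clique S to be avoided. Without a clique separation A is
  -- complete: for non-adjacent a and b, the component of b in A - N[a] has its border in N(a), and
  -- two non-adjacent border vertices would give a hole through a.
  chordal-simplicial : ∀ A S → HoleFree A → Clique S → Outside S A → ¬ ¬ ∃ λ v → v ∈ A × ¬ S v × Simplicial A v
  chordal-simplicial = separation-induction HoleFree Simplicial
    (λ A′⊆A free H H⊆ → free H (A′⊆A ∘ H⊆))
    (λ A′⊆A nb simp (s∈ , vs) (t∈ , vt) → simp (nb s∈ vs , vs) (nb t∈ vt , vt))
    base
    where
    base : ∀ A S → HoleFree A → Clique S → Outside S A → ¬ Separation A → ¬ ¬ ∃ λ v → v ∈ A × ¬ S v × Simplicial A v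
    base A S free clS (u₀ , u₀∈A , u₀∉S) ¬sep k =
      k (u₀ , u₀∈A , u₀∉S , λ {s} {t} (s∈ , _) (t∈ , _) s≢t → decidable-stable (adj? s t) (¬sep ∘ separate s∈ t∈ s≢t))
      where
      separate : ∀ {a b} → a ∈ A → b ∈ A → a ≢ b → ¬ Adj a b → Separation A
      separate {a} {b} a∈ b∈ a≢b a≁b = record
        { W = Walk P b ; w₀∈W = end (b∈ , a≢b ∘ sym , a≁b) ; W⊆A = proj₁ ∘ target
        ; a∈A = a∈ ; a∉W = λ W → target W .proj₂ .proj₁ refl ; a≁W = λ W → target W .proj₂ .proj₂
        ; clique = λ {s} {t} Bs Bt s≢t → decidable-stable (adj? s t) (border Bs Bt s≢t) }
        where
        P : Vert → Set
        P w = w ∈ A × w ≢ a × ¬ Adj a w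
        Border : Vert → Set
        Border s = s ∈ A × ¬ Walk P b s × ∃ λ w → Walk P b w × Adj s w
        border⇒adj : ∀ {s} → Border s → Adj a s
        border⇒adj {s} (s∈ , ¬Ws , w , W , sw) = decidable-stable (adj? a s) λ a≁s →
          ¬Ws (W ▻ (adj-sym sw , s∈ , (λ { refl → target W .proj₂ .proj₂ sw }) , a≁s))
        border : ∀ {s t} → Border s → Border t → s ≢ t → ¬ ¬ Adj s t
        border {s} {t} Bs@(s∈ , _ , w , W , sw) Bt@(t∈ , _ , w′ , W′ , tw′) s≢t s≁t =
          free hole λ w∈ → [ (λ { refl → a∈ }) , R⊆A ]′ (within w∈)
          where
          R : Vert → Set
          R w = w ≡ s ⊎ w ≡ t ⊎ P w
          R⊆A : ∀ {w} → R w → w ∈ A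
          R⊆A (inj₁ refl) = s∈
          R⊆A (inj₂ (inj₁ refl)) = t∈
          R⊆A (inj₂ (inj₂ (w∈ , _))) = w∈
          avoids : ∀ {w} → R w → w ≢ a × (Adj a w → w ≡ s ⊎ w ≡ t)
          avoids (inj₁ refl) = (λ { refl → irrefl (border⇒adj Bs) }) , λ _ → inj₁ refl
          avoids (inj₂ (inj₁ refl)) = (λ { refl → irrefl (border⇒adj Bt) }) , λ _ → inj₂ refl
          avoids (inj₂ (inj₂ (_ , w≢a , a≁w))) = w≢a , λ e → contradiction e a≁w
          open HoleThrough (hole-through (border⇒adj Bs) (border⇒adj Bt) s≢t s≁t avoids
            ((inj₁ refl , sw) ◅ (mapW (inj₂ ∘ inj₂) (reverse W ++ W′) ▻ (adj-sym tw′ , inj₂ (inj₁ refl)))))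

  -- Near-simplicial vertices under the NC property

  NearSimplicial : Subset n → Vert → Set
  NearSimplicial A v = ∃ λ w → Clique λ s → s ∈ A × Adj v s × s ≢ w

  module _ (X : Vert → Set) (covered : (H : Hole G) → ∃[ i ] X (vtx H i)) (setNC : SetNC G X) where
    open NC G X setNC

    near-simplicial : ∀ A S → Clique S → Outside S A → ¬ ¬ ∃ λ v → v ∈ A × ¬ S v × NearSimplicial A v
    near-simplicial A S = separation-induction (λ _ → ⊤) NearSimplicial _
      (λ A′⊆A nb (w , simp) → w , λ (s∈ , vs , s≢w) (t∈ , vt , t≢w) → simp (nb s∈ vs , vs , s≢w) (nb t∈ vt , vt , t≢w))
      base A S tt
      where
      base : ∀ A S → ⊤ → Clique S → Outside S A → ¬ Separation A → ¬ ¬ ∃ λ v → v ∈ A × ¬ S v × NearSimplicial A v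
      base A S _ clS (u₀ , u₀∈A , u₀∉S) ¬sep k = ¬¬-decidable Y finish
        where
        -- Only the cover vertices on holes inside A are set aside. Every hole in A meets them, so
        -- the rest is chordal.
        Y : Vert → Set
        Y x = X x × Σ (Hole G) λ H → HoleIn (_∈ A) H × x ∈ₕ H

        Y⊆A : ∀ {x} → Y x → x ∈ A
        Y⊆A (_ , H , H⊆A , x∈) = H⊆A x∈

        -- If u were off U, its component in A - N[x] - U would be one side of a clique separation,
        -- with x beyond the border.
        far⇒cohole : ∀ {x u} → Y x → u ∈ A → u ≢ x → ¬ Adj x u → ¬ ¬ Cohole (_∈ A) x u
        far⇒cohole {x} {u} Yx u∈ u≢x x≁u ¬U = ¬sep record
          { W = D ; w₀∈W = end (u∈ , u≢x , x≁u , ¬U) ; W⊆A = proj₁ ∘ target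
          ; a∈A = Y⊆A Yx ; a∉W = λ W → target W .proj₂ .proj₁ refl
          ; a≁W = λ W → target W .proj₂ .proj₂ .proj₁ ; clique = border-clique }
          where open Component {_∈ A} {x} {u} (proj₁ Yx) (Y⊆A Yx)

        Y-clique : ∀ {x y} → Y x → Y y → x ≢ y → Adj x y
        Y-clique {x} {y} Yx Yy x≢y = decidable-stable (adj? x y) λ x≁y →
          far⇒cohole Yx (Y⊆A Yy) (x≢y ∘ sym) x≁y λ (H , _ , x∈ , y∈) →
            x≢y (unique-X H (proj₁ Yx) (proj₁ Yy) x∈ y∈)

        not-both-far : ∀ {x y b} → Y x → Y y → x ≢ y → b ∈ A → b ≢ x → b ≢ y → ¬ Adj x b → ¬ Adj y b → ⊥
        not-both-far Yx Yy x≢y b∈ b≢x b≢y x≁b y≁b =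
          far⇒cohole Yx b∈ b≢x x≁b λ Ux → far⇒cohole Yy b∈ b≢y y≁b λ Uy →
          no-common-far (proj₁ Yx) (proj₁ Yy) x≢y (Y-clique Yx Yy x≢y) b≢x b≢y (x≁b ∘ adj-sym) (y≁b ∘ adj-sym) Ux Uy

        finish : ¬ (∀ x → Dec (Y x))
        finish Y? = not-inside λ out → chordal-simplicial B S B-free clS out λ (v , v∈B , v∉S , simp) →
          k (v , B⊆A v∈B , v∉S , near v∈B simp)
          where
          B? : ∀ u → Dec (u ∈ A × ¬ Y u)
          B? u = u ∈? A ×-dec ¬? (Y? u)
          B : Subset n
          B = ⟦ B? ⟧
          B⊆A : B ⊆ A
          B⊆A = proj₁ ∘ ∈⟦⟧⁻ B?

          B-free : HoleFree B
          B-free H H⊆B with covered H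
          ... | i , Xi = ∈⟦⟧⁻ B? (H⊆B (i , refl)) .proj₂ (Xi , H , (B⊆A ∘ H⊆B) , i , refl)

          -- A hole through a vertex x of Y has two non-adjacent neighbours of x, both in B.
          not-inside : ¬ ¬ Outside S B
          not-inside ¬out with Y? u₀
          ... | no ¬Y = ¬out (u₀ , ∈⟦⟧⁺ B? (u₀∈A , ¬Y) , u₀∉S)
          ... | yes (Xx , H , H⊆A , x∈) with far-vertex H x∈
          ... | b , b∈ , b≢x , b≁x with arcs b∈ x∈ b≢x b≁x
          ... | C₁ , C₂ , ap = inS C₁ λ S₁ → inS C₂ λ S₂ →
                ap (a∈ C₁) (a∈ C₂) .proj₂ (clS S₁ S₂ (ap (a∈ C₁) (a∈ C₂) .proj₁))
            where
            open Arc
            inS : ∀ (C : Arc H b u₀) → ¬ ¬ S (a C)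
            inS C ¬S = ¬out (a C , ∈⟦⟧⁺ B? (H⊆A (In⊆ C (a∈ C)) , λ (Xa , _) →
              x∉ C (a∈ C) (unique-X H Xa Xx (In⊆ C (a∈ C)) x∈)) , ¬S)

          module _ {v : Vert} (v∈B : v ∈ B) (simp : Simplicial B v) where
            near-B : ∀ {b c} → b ∈ B → c ∈ B → Near v b → Near v c → Near c b
            near-B b∈ c∈ (inj₁ refl) (inj₁ refl) = inj₁ refl
            near-B b∈ c∈ (inj₁ refl) (inj₂ vc) = inj₂ (adj-sym vc)
            near-B b∈ c∈ (inj₂ vb) (inj₁ refl) = inj₂ vb
            near-B {b} {c} b∈ c∈ (inj₂ vb) (inj₂ vc) with c ≟F b
            ... | yes c≡b = inj₁ c≡b
            ... | no c≢b = inj₂ (simp (c∈ , vc) (b∈ , vb) c≢b)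

            B≢Y : ∀ {b y} → b ∈ B → Y y → b ≢ y
            B≢Y b∈ Yy refl = ∈⟦⟧⁻ B? b∈ .proj₂ Yy

            Missing : Vert → Vert → Set
            Missing x b = Y x × b ∈ B × Near v b × ¬ Adj x b

            -- For distinct x and y, either b or c is missed by both, contrary to `not-both-far`, or
            -- x, c, b, y form the square excluded by `no-square`. So one exempt vertex suffices.
            missing-unique : ∀ {x b y c} → Missing x b → Missing y c → x ≡ y
            missing-unique {x} {b} {y} {c} (Yx , b∈ , vb , x≁b) (Yy , c∈ , vc , y≁c) =
              decidable-stable (x ≟F y) (absurd (near-B b∈ c∈ vb vc))
              where
              absurd : Near c b → ¬ ¬ x ≡ y
              absurd (inj₁ refl) x≢y = not-both-far Yx Yy x≢y (B⊆A b∈) (B≢Y b∈ Yx) (B≢Y b∈ Yy) x≁b y≁c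
              absurd (inj₂ cb) x≢y with adj? x c | adj? y b
              ... | no x≁c | _ = not-both-far Yx Yy x≢y (B⊆A c∈) (B≢Y c∈ Yx) (B≢Y c∈ Yy) x≁c y≁c
              ... | yes _ | no y≁b = not-both-far Yx Yy x≢y (B⊆A b∈) (B≢Y b∈ Yx) (B≢Y b∈ Yy) x≁b y≁b
              ... | yes xc | yes yb = no-square (proj₁ Yx) (proj₁ Yy) x≢y xc cb (adj-sym yb)
                    (Y-clique Yy Yx (x≢y ∘ sym)) (B≢Y b∈ Yx ∘ sym) (B≢Y c∈ Yy) x≁b (y≁c ∘ adj-sym)

            near-with : ∀ w → (∀ {x b} → Missing x b → x ≡ w) → NearSimplicial A v
            near-with w miss = w , adj
              where
              adj-Y : ∀ {s t} → Y s → s ≢ w → t ∈ B → Adj v t → Adj s t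
              adj-Y {s} {t} Ys s≢w t∈ vt = decidable-stable (adj? s t) λ s≁t → s≢w (miss (Ys , t∈ , inj₂ vt , s≁t))
              adj : Clique λ s → s ∈ A × Adj v s × s ≢ w
              adj {s} {t} (s∈ , vs , s≢w) (t∈ , vt , t≢w) s≢t with Y? s | Y? t
              ... | yes Ys | yes Yt = Y-clique Ys Yt s≢t
              ... | yes Ys | no ¬Yt = adj-Y Ys s≢w (∈⟦⟧⁺ B? (t∈ , ¬Yt)) vt
              ... | no ¬Ys | yes Yt = adj-sym (adj-Y Yt t≢w (∈⟦⟧⁺ B? (s∈ , ¬Ys)) vs)
              ... | no ¬Ys | no ¬Yt = simp (∈⟦⟧⁺ B? (s∈ , ¬Ys) , vs) (∈⟦⟧⁺ B? (t∈ , ¬Yt) , vt) s≢t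

            near : NearSimplicial A v
            near with any? (λ x → any? λ b → Y? x ×-dec (b ∈? B ×-dec (near? v b ×-dec ¬? (adj? x b))))
            ... | yes (x , b , M) = near-with x λ M′ → missing-unique M′ M
            -- No vertex has to be exempted; v is a harmless choice, not being its own neighbour.
            ... | no ¬M = near-with v λ M → contradiction (_ , _ , M) ¬M

-- Counting

does⁻ : ∀ {P : Set} (P? : Dec P) → does P? ≡ true → P
does⁻ (yes p) _ = p

𝟙 : ∀ {P : Set} → Dec P → ℕ
𝟙 (yes _) = 1
𝟙 (no _)  = 0

𝟙-cong : ∀ {P Q : Set} (P? : Dec P) (Q? : Dec Q) → (P → Q) → (Q → P) → 𝟙 P? ≡ 𝟙 Q?
𝟙-cong (yes p) (yes q) f g = refl
𝟙-cong (yes p) (no ¬q) f g = contradiction (f p) ¬q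
𝟙-cong (no ¬p) (yes q) f g = contradiction (g q) ¬p
𝟙-cong (no ¬p) (no ¬q) f g = refl

count : ∀ {n} {P : Fin n → Set} → (∀ i → Dec (P i)) → ℕ
count P? = sum λ i → 𝟙 (P? i)

count-cong : ∀ {n} {P Q : Fin n → Set} (P? : ∀ i → Dec (P i)) (Q? : ∀ i → Dec (Q i)) →
             (∀ {i} → P i → Q i) → (∀ {i} → Q i → P i) → count P? ≡ count Q?
count-cong P? Q? f g = sum-cong-≗ λ i → 𝟙-cong (P? i) (Q? i) f g

_without_ : ∀ {n} {P : Fin n → Set} → (∀ i → Dec (P i)) → ∀ z i → Dec (P i × i ≢ z)
(P? without z) i = P? i ×-dec ¬? (i ≟F z)

count-without : ∀ {n} {P : Fin n → Set} (P? : ∀ i → Dec (P i)) {z} → P z → count P? ≡ suc (count (P? without z))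
count-without P? {zero} Pz = cong₂ _+_
  (trans (𝟙-cong (P? zero) (yes tt) _ (λ _ → Pz))
    (cong suc (sym (𝟙-cong ((P? without zero) zero) (no id) (λ (_ , 0≢0) → 0≢0 refl) ⊥-elim))))
  (count-cong (P? ∘ suc) ((P? without zero) ∘ suc) (_, λ ()) proj₁)
count-without P? {suc z} Pz = trans
  (cong₂ _+_ (𝟙-cong (P? zero) ((P? without suc z) zero) (_, λ ()) proj₁)
    (trans (count-without (P? ∘ suc) Pz) (cong suc
      (count-cong ((P? ∘ suc) without z) ((P? without suc z) ∘ suc)
        (λ (p , ne) → p , λ { refl → ne refl }) (λ (p , ne) → p , ne ∘ cong suc)))))
  (+-suc _ _)

-- Induction on the domain: the image of its first point is deleted from the target, which lowers
-- that count by one.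
count-injection : ∀ {m n} {P : Fin m → Set} {Q : Fin n → Set} (P? : ∀ i → Dec (P i)) (Q? : ∀ j → Dec (Q j))
                  (h : ∀ {i} → P i → Fin n) → (∀ {i} (p : P i) → Q (h p)) →
                  (∀ {i j} (p : P i) (q : P j) → h p ≡ h q → i ≡ j) → count P? ≤ count Q?
count-injection {zero} P? Q? h hQ inj = z≤n
count-injection {suc m} P? Q? h hQ inj with P? zero
... | no _ = count-injection (P? ∘ suc) Q? h hQ λ p q eq → F.suc-injective (inj p q eq)
... | yes p₀ = ≤-trans
  (s≤s (count-injection (P? ∘ suc) (Q? without h p₀) h (λ p → hQ p , λ eq → case inj p p₀ eq of λ ())
    λ p q eq → F.suc-injective (inj p q eq)))
  (≤-reflexive (sym (count-without Q? (hQ p₀))))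

count-injection-< : ∀ {m n} {P : Fin m → Set} {Q : Fin n → Set} (P? : ∀ i → Dec (P i)) (Q? : ∀ j → Dec (Q j))
                    (h : ∀ {i} → P i → Fin n) → (∀ {i} (p : P i) → Q (h p)) →
                    (∀ {i j} (p : P i) (q : P j) → h p ≡ h q → i ≡ j) →
                    ∀ {z} → Q z → (∀ {i} (p : P i) → h p ≢ z) → count P? < count Q?
count-injection-< P? Q? h hQ inj Qz miss = ≤-trans
  (s≤s (count-injection P? (Q? without _) h (λ p → hQ p , miss p) inj))
  (≤-reflexive (sym (count-without Q? Qz)))

count-complement : ∀ {n} {P : Fin n → Set} (P? : ∀ i → Dec (P i)) → count P? + count (¬? ∘ P?) ≡ n
count-complement {zero} P? = refl
count-complement {suc n} P? with P? zero
... | yes _ = cong suc (count-complement (P? ∘ suc))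
... | no _  = trans (+-suc _ _) (cong suc (count-complement (P? ∘ suc)))

count-⊤ : ∀ n → count {n} (λ _ → yes tt) ≡ n
count-⊤ zero    = refl
count-⊤ (suc n) = cong suc (count-⊤ n)

count⇒injection : ∀ {n} {P : Fin n → Set} (P? : ∀ i → Dec (P i)) k → k ≤ count P? →
                  Σ (Fin k → Fin n) λ h → (∀ c → P (h c)) × (∀ c d → h c ≡ h d → c ≡ d)
count⇒injection P? zero _ = (λ ()) , (λ ()) , λ ()
count⇒injection {suc n} P? (suc k) le with P? zero
... | no _ = let h , hP , inj = count⇒injection (P? ∘ suc) (suc k) le in
  suc ∘ h , hP , λ c d eq → inj c d (F.suc-injective eq)
... | yes p₀ with count⇒injection (P? ∘ suc) k (≤-pred le)
... | h , hP , inj = (λ { zero → zero ; (suc c) → suc (h c) }) , (λ { zero → p₀ ; (suc c) → hP c }) ,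
  λ { zero zero eq → refl ; (suc c) (suc d) eq → cong suc (inj c d (F.suc-injective eq)) }

sum-mono : ∀ {n} {f g : Fin n → ℕ} → (∀ i → f i ≤ g i) → sum f ≤ sum g
sum-mono {zero}  le = z≤n
sum-mono {suc n} le = ℕ.+-mono-≤ (le zero) (sum-mono (le ∘ suc))

sum-mono-< : ∀ {n} {f g : Fin n → ℕ} → (∀ i → f i ≤ g i) → ∀ {i} → f i < g i → sum f < sum g
sum-mono-< le {zero}  lt = ℕ.+-mono-<-≤ lt (sum-mono (le ∘ suc))
sum-mono-< le {suc i} lt = ℕ.+-mono-≤-< (le zero) (sum-mono-< (le ∘ suc) lt)

-- Summing 1 / r p over the pairs (p , i) in N gives k, and so does summing 1 / c i; the factor k !
-- clears denominators.
module Square {k : ℕ} {N : Fin k → Fin k → Set} (N? : ∀ p i → Dec (N p i)) where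
  r c : Fin k → ℕ
  r p = count (N? p)
  c i = count λ p → N? p i

  module _ (r>0 : ∀ p → 0 < r p) (c>0 : ∀ i → 0 < c i) (r≤c : ∀ {p i} → N p i → r p ≤ c i) where
    private
      count≤ : ∀ {n} {P : Fin n → Set} (P? : ∀ i → Dec (P i)) → count P? ≤ n
      count≤ P? = ≤-trans (m≤m+n _ _) (≤-reflexive (count-complement P?))

      quotient : ∀ t → 0 < t → t ≤ k → ∃ λ q → t * q ≡ k !
      quotient (suc t) _ t≤k with ∣-trans (m∣m*n {suc t} (t !)) (m≤n⇒m!∣n! t≤k)
      ... | divides q eq = q , trans (ℕ.*-comm (suc t) q) (sym eq)

      r/ : ∀ p → ∃ λ q → r p * q ≡ k !
      r/ p = quotient (r p) (r>0 p) (count≤ (N? p))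

      c/ : ∀ i → ∃ λ q → c i * q ≡ k !
      c/ i = quotient (c i) (c>0 i) (count≤ λ p → N? p i)

      antitone-< : ∀ {s t q q′} → s * q ≡ k ! → t * q′ ≡ k ! → s < t → q′ < q
      antitone-< {s} {t} {q} {q′} e e′ s<t = ℕ.≰⇒> λ q≤q′ → <-irrefl (trans e (sym e′))
        (≤-<-trans (ℕ.*-monoʳ-≤ s q≤q′) (ℕ.*-monoˡ-< q′ {{nonZero q′ e′}} s<t))
        where
        nonZero : ∀ q′ → t * q′ ≡ k ! → NonZero q′
        nonZero zero e′ = contradiction (trans (sym (ℕ.*-zeroʳ t)) e′) (<⇒≢ (ℕ.1≤n! k))
        nonZero (suc _) _ = _

      antitone : ∀ {s t q q′} → 0 < s → s * q ≡ k ! → t * q′ ≡ k ! → s ≤ t → q′ ≤ q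
      antitone {s} {t} {q} {q′} 0<s e e′ s≤t with m≤n⇒m<n∨m≡n s≤t
      ... | inj₁ s<t = <⇒≤ (antitone-< e e′ s<t)
      ... | inj₂ refl = ≤-reflexive (ℕ.*-cancelˡ-≡ q′ q s {{>-nonZero 0<s}} (trans e′ (sym e)))

      by-row by-column : Fin k → Fin k → ℕ
      by-row    p i = 𝟙 (N? p i) * proj₁ (r/ p)
      by-column p i = 𝟙 (N? p i) * proj₁ (c/ i)

      rows : sum (λ p → sum (by-row p)) ≡ sum {k} (λ _ → k !)
      rows = sum-cong-≗ λ p → trans (sym (*-distribʳ-sum (proj₁ (r/ p)) λ i → 𝟙 (N? p i))) (proj₂ (r/ p))

      columns : sum (λ p → sum (by-column p)) ≡ sum {k} (λ _ → k !)
      columns = trans (∑-comm by-column)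
        (sum-cong-≗ λ i → trans (sym (*-distribʳ-sum (proj₁ (c/ i)) λ p → 𝟙 (N? p i))) (proj₂ (c/ i)))

      column≤row : ∀ p i → by-column p i ≤ by-row p i
      column≤row p i with N? p i
      ... | no _ = z≤n
      ... | yes Npi = ℕ.+-monoˡ-≤ 0 (antitone (r>0 p) (proj₂ (r/ p)) (proj₂ (c/ i)) (r≤c Npi))

    -- The row-weighted and column-weighted double sums both equal k times k !, and the terms
    -- compare one by one, so no term can be strictly smaller.
    no-strict : ∀ {p i} → N p i → ¬ r p < c i
    no-strict {p} {i} Npi lt = <-irrefl (trans columns (sym rows))
      (sum-mono-< (λ p → sum-mono (column≤row p)) {p} (sum-mono-< (column≤row p) {i} strict))
      where
      strict : by-column p i < by-row p i
      strict with N? p i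
      ... | no ¬N = contradiction Npi ¬N
      ... | yes _ = ℕ.+-monoˡ-< 0 (antitone-< (proj₂ (r/ p)) (proj₂ (c/ i)) lt)

-- Unions of k edge-disjoint k-cliques

module Lines (G : Graph) (k : ℕ) (L : Fin k → Fin k → V G) (cliques : UnionOfEdgeDisjointCliques G k L) where
  open Separations G
  open Holes G

  On : Fin k → Vert → Set
  On = InClique G L

  on? : ∀ i u → Dec (On i u)
  on? i u = any? λ a → L i a ≟F u

  line-of : ∀ u → ∃ λ i → On i u
  line-of = cliques .proj₂ .proj₂ .proj₁

  line-through : ∀ {u v} → Adj u v → ∃ λ i → On i u × On i v
  line-through = cliques .proj₂ .proj₂ .proj₂ .proj₁ _ _

  meet-once : ∀ {i j u v} → i ≢ j → On i u → On i v → On j u → On j v → u ≡ v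
  meet-once {u = u} {v} i≢j iu iv ju jv = decidable-stable (u ≟F v) λ u≢v →
    cliques .proj₂ .proj₂ .proj₂ .proj₂ _ _ i≢j _ _ u≢v iu iv ju jv

  -- Degree at least k inside A, as k listed neighbours: this suits the pigeonhole arguments, and
  -- the clique Q is built from the list.
  HighDegree : Subset n → Set
  HighDegree A = ∀ {v} → v ∈ A →
    Σ (Fin k → Vert) λ g → (∀ c → g c ∈ A × Adj v (g c)) × (∀ c d → g c ≡ g d → c ≡ d)

  -- The vertex e a and its k listed neighbours are k + 1 distinct vertices, more than e can
  -- enumerate.
  escape : ∀ {A} → HighDegree A → ∀ (e : Fin k → Vert) {a} → e a ∈ A →
           ∃ λ u → u ∈ A × Adj (e a) u × ¬ ∃ λ b → e b ≡ u
  escape {A} deg e {a} v∈A with deg v∈A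
  ... | g , g∈ , g-inj with any? (λ c → ¬? (any? λ b → e b ≟F g c))
  ... | yes (c , ∉e) = g c , g∈ c .proj₁ , g∈ c .proj₂ , ∉e
  ... | no ¬c = ⊥-elim (collide (pigeonhole (n<1+n k) f))
    where
    in-e : ∀ c → ∃ λ b → e b ≡ g c
    in-e c = decidable-stable (any? λ b → e b ≟F g c) λ ∉e → ¬c (c , ∉e)
    f : Fin (suc k) → Fin k
    f zero    = a
    f (suc c) = in-e c .proj₁
    collide : ¬ ∃₂ λ x y → x F.< y × f x ≡ f y
    collide (zero , suc c , _ , eq) =
      irrefl (subst (Adj (e a)) (sym (trans (cong e eq) (in-e c .proj₂))) (g∈ c .proj₂))
    collide (suc c , suc d , s≤s c<d , eq) =
      <⇒≢ c<d (cong toℕ (g-inj c d (trans (sym (in-e c .proj₂)) (trans (cong e eq) (in-e d .proj₂)))))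

  -- A line has only k vertices, so u has a neighbour off line i, and the line joining the two is a
  -- different one.
  other-line : ∀ {A} → HighDegree A → ∀ {u i} → u ∈ A → On i u → ∃ λ j → j ≢ i × On j u
  other-line deg {i = i} u∈A (a , refl) with escape deg (L i) u∈A
  ... | w , _ , uw , w∉i with line-through uw
  ... | j , ju , jw = j , (λ { refl → w∉i jw }) , ju

  -- The linear space on a k-clique

  module _ {A : Subset n} (0<k : 0 < k) (deg : HighDegree A) (Q : Fin k → Vert) (Q∈A : ∀ p → Q p ∈ A)
           (Q-adj : ∀ {p q} → p ≢ q → Adj (Q p) (Q q)) where
    private
      Q-inj : ∀ {p q} → Q p ≡ Q q → p ≡ q
      Q-inj {p} {q} eq = decidable-stable (p ≟F q) λ p≢q → irrefl (subst (Adj (Q p)) (sym eq) (Q-adj p≢q))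

      -- Each of the k points of Q would lie on a further line. These lines are distinct, as a
      -- common one would meet line i twice; together with i they are k + 1 lines.
      no-full-line : ∀ i → ¬ (∀ p → On i (Q p))
      no-full-line i full = collide (pigeonhole (n<1+n k) f)
        where
        o : ∀ p → ∃ λ j → j ≢ i × On j (Q p)
        o p = other-line deg (Q∈A p) (full p)
        f : Fin (suc k) → Fin k
        f zero    = i
        f (suc p) = o p .proj₁
        collide : ¬ ∃₂ λ x y → x F.< y × f x ≡ f y
        collide (zero , suc p , _ , eq) = o p .proj₂ .proj₁ (sym eq)
        collide (suc p , suc q , s≤s p<q , eq) = <⇒≢ p<q (cong toℕ (Q-inj
          (meet-once (o p .proj₂ .proj₁) (o p .proj₂ .proj₂) (subst (λ j → On j (Q q)) (sym eq) (o q .proj₂ .proj₂))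
                     (full p) (full q))))

      q₀ : Fin k
      q₀ = fromℕ< 0<k

      -- Non-incidence: r p counts the lines missing the point `Q p`, and c i counts the points of Q
      -- off line i.
      N? : ∀ p i → Dec (¬ On i (Q p))
      N? p i = ¬? (on? i (Q p))

      open Square N?

      outside : ∃ λ u → u ∈ A × Adj (Q q₀) u × ¬ ∃ λ p → Q p ≡ u
      outside = escape deg Q (Q∈A q₀)

      u : Vert
      u = outside .proj₁

      u∉Q : ∀ p → Q p ≢ u
      u∉Q p eq = outside .proj₂ .proj₂ .proj₂ (p , eq)

      i j : Fin k
      i = line-of u .proj₁
      j = other-line deg (outside .proj₂ .proj₁) (line-of u .proj₂) .proj₁

      iu : On i u
      iu = line-of u .proj₂

      ju : On j u
      ju = other-line deg (outside .proj₂ .proj₁) (line-of u .proj₂) .proj₂ .proj₂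

      j≢i : j ≢ i
      j≢i = other-line deg (outside .proj₂ .proj₁) (line-of u .proj₂) .proj₂ .proj₁

      not-both-on : ∀ {p} → On i (Q p) → On j (Q p) → ⊥
      not-both-on {p} ip jp = u∉Q p (meet-once (j≢i ∘ sym) ip iu jp ju)

      count-pos : ∀ {P : Fin k → Set} (P? : ∀ i → Dec (P i)) → ∃ P → 0 < count P?
      count-pos P? (z , Pz) = subst (0 <_) (sym (count-without P? Pz)) (s≤s z≤n)

      r>0 : ∀ p → 0 < r p
      r>0 p = count-pos (N? p) (case on? i (Q p) of λ where
        (yes ip) → j , not-both-on ip
        (no ¬ip) → i , ¬ip)

      c>0 : ∀ l → 0 < c l
      c>0 l = count-pos (λ p → N? p l) (decidable-stable (any? λ p → N? p l) λ ¬p →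
        no-full-line l λ p → decidable-stable (on? l (Q p)) λ ¬lp → ¬p (p , ¬lp))

      module _ {p l : Fin k} (p∉l : ¬ On l (Q p)) where
        join : ∀ {q} → On l (Q q) → ∃ λ m → On m (Q q) × On m (Q p)
        join lq = line-through (Q-adj λ { refl → p∉l lq })

        -- A line through `Q p` differs from l, so it meets l at most once.
        join-inj : ∀ {q q′} (lq : On l (Q q)) (lq′ : On l (Q q′)) → join lq .proj₁ ≡ join lq′ .proj₁ → q ≡ q′
        join-inj {q} {q′} lq lq′ eq = Q-inj (meet-once (λ m≡l → p∉l (subst (λ m → On m (Q p)) m≡l (join lq .proj₂ .proj₂)))
          (join lq .proj₂ .proj₁) (subst (λ m → On m (Q q′)) (sym eq) (join lq′ .proj₂ .proj₁)) lq lq′)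

        points≤lines : count (λ q → on? l (Q q)) ≤ count (λ m → on? m (Q p))
        points≤lines = count-injection (λ q → on? l (Q q)) (λ m → on? m (Q p)) (λ lq → join lq .proj₁)
          (λ lq → join lq .proj₂ .proj₂) join-inj

        -- The line m passes through `Q p` but joins it to no point of Q on l, so `join` never takes
        -- the value m.
        points<lines : ∀ {m} → On m (Q p) → (∀ {q} → On l (Q q) → On m (Q q) → ⊥) →
                       count (λ q → on? l (Q q)) < count (λ m → on? m (Q p))
        points<lines mp disjoint = count-injection-< (λ q → on? l (Q q)) (λ m → on? m (Q p)) (λ lq → join lq .proj₁)
          (λ lq → join lq .proj₂ .proj₂) join-inj mp
          (λ {q} lq eq → disjoint lq (subst (λ m → On m (Q q)) eq (join lq .proj₂ .proj₁)))

      complement-≤ : ∀ {a b a′ b′} → a + a′ ≡ k → b + b′ ≡ k → a ≤ b → b′ ≤ a′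
      complement-≤ {a} {b} {a′} {b′} e e′ a≤b = ℕ.+-cancelˡ-≤ b b′ a′
        (≤-trans (≤-reflexive (trans e′ (sym e))) (ℕ.+-monoˡ-≤ a′ a≤b))

      complement-< : ∀ {a b a′ b′} → a + a′ ≡ k → b + b′ ≡ k → a < b → b′ < a′
      complement-< {a} {b} {a′} {b′} e e′ a<b = ℕ.+-cancelˡ-< b b′ a′
        (≤-<-trans (≤-reflexive (trans e′ (sym e))) (ℕ.+-monoˡ-< a′ a<b))

      -- Points of Q and lines both number k, so passing to complements reverses `points≤lines`.
      r≤c : ∀ {p l} → ¬ On l (Q p) → r p ≤ c l
      r≤c {p} {l} p∉l = complement-≤ (count-complement λ q → on? l (Q q)) (count-complement λ m → on? m (Q p))
        (points≤lines p∉l)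

      r<c : ∀ {p l m} → ¬ On l (Q p) → On m (Q p) → (∀ {q} → On l (Q q) → On m (Q q) → ⊥) → r p < c l
      r<c {p} {l} p∉l mp disjoint = complement-< (count-complement λ q → on? l (Q q)) (count-complement λ m → on? m (Q p))
        (points<lines p∉l mp disjoint)

    -- Conway's argument for the de Bruijn–Erdős theorem: a point off a line l lies on at least as many
    -- lines as l has points, and lines meeting outside Q make one of these inequalities strict.
    no-k-clique : ⊥
    no-k-clique with any? (λ p → on? i (Q p))
    ... | yes (p , ip) = no-strict r>0 c>0 r≤c (not-both-on ip)
          (r<c (not-both-on ip) ip λ jq iq → not-both-on iq jq)
    -- Line i misses Q altogether, so any point of Q, with any line through it, gives the strict
    -- inequality.
    ... | no i∩Q=∅ = no-strict r>0 c>0 r≤c (i∩Q=∅ ∘ (q₀ ,_))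
          (r<c (i∩Q=∅ ∘ (q₀ ,_)) (line-of (Q q₀) .proj₂) λ iq _ → i∩Q=∅ (_ , iq))

  module _ (0<k : 0 < k) (X : Vert → Set) (covered : (H : Hole G) → ∃[ i ] X (vtx H i)) (setNC : SetNC G X) where

    no-high-degree : ∀ A {u} → u ∈ A → ¬ HighDegree A
    no-high-degree A {u} u∈A deg = near-simplicial X covered setNC A (λ _ → ⊥) (λ ()) (u , u∈A , id) clique
      where
      clique : ¬ ∃ λ v → v ∈ A × ¬ ⊥ × NearSimplicial A v
      clique (v , v∈A , _ , w , simp) with deg v∈A
      ... | g , g∈ , g-inj = no-k-clique 0<k deg Q Q∈A Q-adj
        where
        -- Among the listed neighbours of v at most one is the exempt w. Replacing it by v, which is
        -- adjacent to all the others, leaves k pairwise adjacent vertices.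
        Q : Fin k → Vert
        Q c with g c ≟F w
        ... | yes _ = v
        ... | no _  = g c
        Q∈A : ∀ c → Q c ∈ A
        Q∈A c with g c ≟F w
        ... | yes _ = v∈A
        ... | no _  = g∈ c .proj₁
        Q-adj : ∀ {c d} → c ≢ d → Adj (Q c) (Q d)
        Q-adj {c} {d} c≢d with g c ≟F w | g d ≟F w
        ... | yes p | yes q = contradiction (g-inj c d (trans p (sym q))) c≢d
        ... | yes _ | no _  = g∈ d .proj₂
        ... | no _  | yes _ = adj-sym (g∈ c .proj₂)
        ... | no p  | no q  = simp (g∈ c .proj₁ , g∈ c .proj₂ , p) (g∈ d .proj₁ , g∈ d .proj₂ , q) (c≢d ∘ g-inj c d)

    -- Greedy DP-colouring and the lower bound

    nb? : ∀ A v u → Dec (u ∈ A × Adj v u)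
    nb? A v u = u ∈? A ×-dec adj? v u

    -- `no-high-degree` only refutes; since a vertex of small degree can be searched for, the
    -- refutation yields a witness.
    low-degree : ∀ A {u} → u ∈ A → ∃ λ v → v ∈ A × count (nb? A v) < k
    low-degree A {u} u∈A = decidable-stable (any? λ v → v ∈? A ×-dec count (nb? A v) ℕ.<? k) λ ¬low →
      no-high-degree A u∈A λ {v} v∈A → count⇒injection (nb? A v) k (ℕ.≮⇒≥ λ lt → ¬low (v , v∈A , lt))

    colourable : DPColourable G k
    colourable 𝓗 = let f , ok = colour (suc ∣ all ∣) all ≤-refl in f , λ u v → ok (∈⟦⟧⁺ all? tt) (∈⟦⟧⁺ all? tt)
      where
      open Cover 𝓗
      all? : (u : Vert) → Dec ⊤
      all? _ = yes tt
      all : Subset n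
      all = ⟦ all? ⟧

      Proper : Subset n → (Vert → Fin k) → Set
      Proper A f = ∀ {u v} → u ∈ A → v ∈ A → ¬ M u v (f u) (f v) ≡ true

      -- Every blocked colour has a blocking neighbour of v in A, and by the matching condition one
      -- neighbour blocks at most one colour.
      free-colour : ∀ A v f → count (nb? A v) < k → ∃ λ c → ¬ ∃ λ u → u ∈ A × M v u c (f u) ≡ true
      free-colour A v f deg<k = decidable-stable (any? λ c → ¬? (blocker? c)) λ none →
        ℕ.<⇒≱ deg<k (≤-trans
          (≤-reflexive (sym (count-⊤ k)))
          (count-injection {P = λ _ → ⊤} (λ _ → yes tt) (nb? A v) (λ {c} _ → blocker none c .proj₁)
            (λ {c} _ → blocker none c .proj₂ .proj₁ , onEdges _ _ _ _ (blocker none c .proj₂ .proj₂))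
            λ {c} {d} _ _ eq → matchingʳ v _ c d _ (blocker none c .proj₂ .proj₂)
              (subst (λ u → M v u d (f u) ≡ true) (sym eq) (blocker none d .proj₂ .proj₂))))
        where
        blocker? : ∀ c → Dec (∃ λ u → u ∈ A × M v u c (f u) ≡ true)
        blocker? c = any? λ u → u ∈? A ×-dec M v u c (f u) Bool.≟ true
        blocker : ¬ (∃ λ c → ¬ ∃ λ u → u ∈ A × M v u c (f u) ≡ true) → ∀ c → ∃ λ u → u ∈ A × M v u c (f u) ≡ true
        blocker none c = decidable-stable (blocker? c) λ ¬b → none (c , ¬b)

      remove? : ∀ A v u → Dec (u ∈ A × u ≢ v)
      remove? A v u = u ∈? A ×-dec ¬? (u ≟F v)

      recolour : ∀ {A v} → count (nb? A v) < k → Σ (Vert → Fin k) (Proper ⟦ remove? A v ⟧) → Σ (Vert → Fin k) (Proper A)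
      recolour {A} {v} deg<k (f , f-proper) = insert (free-colour A v f deg<k)
        where
        insert : (∃ λ c → ¬ ∃ λ u → u ∈ A × M v u c (f u) ≡ true) → Σ (Vert → Fin k) (Proper A)
        insert (c , free) = f′ , f′-proper
          where
          f′ : Vert → Fin k
          f′ u with u ≟F v
          ... | yes _ = c
          ... | no _  = f u
          f′-proper : Proper A f′
          f′-proper {u} {w} u∈ w∈ e with u ≟F v | w ≟F v
          ... | yes refl | yes refl = irrefl (onEdges _ _ _ _ e)
          ... | yes refl | no _ = free (w , w∈ , e)
          ... | no _ | yes refl = free (u , u∈ , trans (symM _ _ _ _) e)
          ... | no u≢v | no w≢v = f-proper (∈⟦⟧⁺ (remove? A v) (u∈ , u≢v)) (∈⟦⟧⁺ (remove? A v) (w∈ , w≢v)) e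

      colour : ∀ m A → ∣ A ∣ < m → Σ (Vert → Fin k) (Proper A)
      colour (suc m) A (s≤s ∣A∣≤m) = [ nonempty , empty ]′ (toSum (any? λ u → u ∈? A))
        where
        empty : ¬ (∃ λ u → u ∈ A) → Σ (Vert → Fin k) (Proper A)
        empty A=∅ = (λ _ → fromℕ< 0<k) , λ u∈ → contradiction (_ , u∈) A=∅
        nonempty : (∃ λ u → u ∈ A) → Σ (Vert → Fin k) (Proper A)
        nonempty (_ , u∈A) = let v , v∈A , deg<k = low-degree A u∈A in
          recolour deg<k (colour m ⟦ remove? A v ⟧ (<-≤-trans
            (p⊂q⇒∣p∣<∣q∣ (proj₁ ∘ ∈⟦⟧⁻ (remove? A v) , v , v∈A , λ v∈ → ∈⟦⟧⁻ (remove? A v) v∈ .proj₂ refl)) ∣A∣≤m))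

  -- With identity matchings on all edges a DP-colouring is an ordinary proper colouring, and a
  -- clique of k vertices has none with t colours.
  not-colourable : ∀ t → t < k → ¬ DPColourable G t
  not-colourable t t<k colourable = monochromatic (colourable identity)
    where
    M? : ∀ u v (a b : Fin t) → Dec (Adj u v × a ≡ b)
    M? u v a b = adj? u v ×-dec (a ≟F b)
    identity : Cover G t
    identity = record
      { M = λ u v a b → does (M? u v a b)
      ; onEdges = λ u v a b e → does⁻ (M? u v a b) e .proj₁
      ; symM = λ u v a b → does-⇔ (mk⇔ (λ (e , p) → adj-sym e , sym p) (λ (e , p) → adj-sym e , sym p))
                              (M? u v a b) (M? v u b a)
      ; matchingˡ = λ u v a b b′ e e′ → trans (sym (does⁻ (M? u v a b) e .proj₂)) (does⁻ (M? u v a b′) e′ .proj₂)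
      ; matchingʳ = λ u v a a′ b e e′ → trans (does⁻ (M? u v a b) e .proj₂) (sym (does⁻ (M? u v a′ b) e′ .proj₂)) }
    ℓ : Fin k → Vert
    -- Any line would serve; t < k supplies an index.
    ℓ = L (fromℕ< t<k)
    monochromatic : ¬ DPColouring G identity
    monochromatic (f , proper) =
      let a , b , a<b , eq = pigeonhole t<k (f ∘ ℓ)
          ab = cliques .proj₂ .proj₁ (fromℕ< t<k) a b (<⇒≢ a<b ∘ cong toℕ)
      in proper (ℓ a) (ℓ b) (dec-true (M? (ℓ a) (ℓ b) (f (ℓ a)) (f (ℓ b))) (ab , eq))

theorem3p2 : (k : ℕ) → 1 ≤ k → (G : Graph) → (L : Fin k → Fin k → V G)
    → UnionOfEdgeDisjointCliques G k L
    → NCProperty G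
    → DPChromaticNumberIs G k
theorem3p2 k 0<k G L cliques (X , (_ , covered) , setNC) = colourable 0<k X covered setNC , not-colourable
  where open Lines G k L cliques
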